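{- Let $(r_k(q))_{k\ge 1}$, $(s_k(q))_{k\ge 0}$, $(t_k(q))_{k\ge 1}$ be three sequences of real polynomials in $q$ with nonnegative coefficients, and let $A(q)=[a_{n,k}(q)]_{n,k\ge 0}$ be the infinite lower triangular matrix with $a_{n,k}(q)=0$ unless $n\ge k\ge 0$, defined for $n,k\ge 0$ by $$a_{0,0}(q)=1,\quad a_{n+1,k}(q)=r_{k}(q)a_{n,k-1}(q)+s_k(q)a_{n,k}(q)+t_{k+1}(q)a_{n,k+1}(q),$$ where for $k=0$ the term $r_k(q)a_{n,k-1}(q)$ is $0$. Then $A(q)$ is $q$-TP if one of the following conditions holds: (i) $s_0(q)\ge_q r_1(q)$ and $s_k(q)\ge_q r_{k+1}(q)+t_{k}(q)$ for all $k\ge 1$. (ii) $s_0(q)\ge_q t_1(q)$ and $s_k(q)\ge_q r_k(q)+t_{k+1}(q)$ for all $k\ge 1$. (iii) $s_0(q)\ge_q 1$ and $s_k(q)\ge_q r_k(q)t_k(q)+1$ for all $k\ge 1$.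
   Context: For real polynomials $f(q),g(q)$ in $q$, write $f(q)\ge_q g(q)$ if all coefficients of the difference $f(q)-g(q)$ are nonnegative. An infinite matrix whose entries are real polynomials in $q$ is called $q$-TP if its minors of all orders have nonnegative coefficients as polynomials in $q$. -}

module Defs where

open import Algebra.Bundles.Raw using (RawRing)
import Algebra.Definitions.RawMonoid as RawMonoid
open import Data.Fin.Base as Fin using (Fin; zero; suc; punchIn)
open import Data.List.Base using (List; []; _∷_; map)
open import Data.Nat.Base as ℕ using (ℕ; zero; suc)
import Data.Nat.Properties as ℕ
open import Data.Product.Base using (Σ-syntax; ∃-syntax; _×_; _,_)
open import Data.Rational.Base as ℚ using (ℚ; 0ℚ; ½; 1ℚ)
import Data.Rational.Properties as ℚ
open import Data.Rational.Solver using (module +-*-Solver)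
open import Level using (0ℓ)
open import Relation.Binary.Core using (_Preserves_⟶_)
open import Relation.Binary.PropositionalEquality
  using (_≡_; refl; sym; trans; cong; cong₂; subst)

------------------------------------------------------------------------
-- Real numbers: rational Cauchy sequences, identified when their
-- difference tends to zero

IsCauchy : (ℕ → ℚ) → Set
IsCauchy x = ∀ ε → 0ℚ ℚ.< ε →
  ∃[ N ] (∀ m n → N ℕ.≤ m → N ℕ.≤ n → ℚ.∣ x m ℚ.- x n ∣ ℚ.< ε)

private abstract
  halves : ∀ ε → ½ ℚ.* ε ℚ.+ ½ ℚ.* ε ≡ ε
  halves ε = trans (sym (ℚ.*-distribʳ-+ ε ½ ½)) (ℚ.*-identityˡ ε)

  ½-pos : ∀ {ε} → 0ℚ ℚ.< ε → 0ℚ ℚ.< ½ ℚ.* ε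
  ½-pos {ε} 0<ε = subst (ℚ._< ½ ℚ.* ε) (ℚ.*-zeroʳ ½) (ℚ.*-monoʳ-<-pos ½ 0<ε)

  bound : ∀ x → IsCauchy x →
          ∃[ B ] (0ℚ ℚ.< B × ∃[ N ] (∀ n → N ℕ.≤ n → ℚ.∣ x n ∣ ℚ.≤ B))
  bound x xc with xc 1ℚ (ℚ.positive⁻¹ 1ℚ)
  ... | N , close = 1ℚ ℚ.+ ℚ.∣ x N ∣ , 0<B , N , bounded
    where
    open ℚ.≤-Reasoning
    0<B : 0ℚ ℚ.< 1ℚ ℚ.+ ℚ.∣ x N ∣
    0<B = ℚ.+-mono-<-≤ (ℚ.positive⁻¹ 1ℚ) (ℚ.0≤∣p∣ (x N))
    split : ∀ a b → a ≡ (a ℚ.- b) ℚ.+ b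
    split = solve 2 (λ a b → a := (a :- b) :+ b) refl
      where open +-*-Solver
    bounded : ∀ n → N ℕ.≤ n → ℚ.∣ x n ∣ ℚ.≤ 1ℚ ℚ.+ ℚ.∣ x N ∣
    bounded n N≤n = begin
      ℚ.∣ x n ∣                           ≡⟨ cong ℚ.∣_∣ (split (x n) (x N)) ⟩
      ℚ.∣ (x n ℚ.- x N) ℚ.+ x N ∣         ≤⟨ ℚ.∣p+q∣≤∣p∣+∣q∣ (x n ℚ.- x N) (x N) ⟩
      ℚ.∣ x n ℚ.- x N ∣ ℚ.+ ℚ.∣ x N ∣     ≤⟨ ℚ.+-monoˡ-≤ ℚ.∣ x N ∣ (ℚ.<⇒≤ (close n N N≤n ℕ.≤-refl)) ⟩
      1ℚ ℚ.+ ℚ.∣ x N ∣                    ∎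

  const-cauchy : ∀ p → IsCauchy (λ _ → p)
  const-cauchy p ε 0<ε = 0 , λ _ _ _ _ →
    subst (ℚ._< ε) (sym (cong ℚ.∣_∣ (ℚ.+-inverseʳ p))) 0<ε

  neg-cauchy : ∀ x → IsCauchy x → IsCauchy (λ n → ℚ.- x n)
  neg-cauchy x xc ε 0<ε with xc ε 0<ε
  ... | N , close = N , λ m n N≤m N≤n →
    subst (ℚ._< ε) (sym (trans (cong ℚ.∣_∣ (rearrange (x m) (x n)))
                               (ℚ.∣-p∣≡∣p∣ (x m ℚ.- x n))))
          (close m n N≤m N≤n)
    where
    open +-*-Solver
    rearrange : ∀ a b → (ℚ.- a) ℚ.- (ℚ.- b) ≡ ℚ.- (a ℚ.- b)
    rearrange = solve 2 (λ a b → (:- a) :- (:- b) := :- (a :- b)) refl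

  +-cauchy : ∀ x y → IsCauchy x → IsCauchy y → IsCauchy (λ n → x n ℚ.+ y n)
  +-cauchy x y xc yc ε 0<ε with xc (½ ℚ.* ε) (½-pos 0<ε) | yc (½ ℚ.* ε) (½-pos 0<ε)
  ... | M , closeˣ | N , closeʸ = M ℕ.⊔ N , close
    where
    open ℚ.≤-Reasoning
    rearrange : ∀ a b c d → (a ℚ.+ b) ℚ.- (c ℚ.+ d) ≡ (a ℚ.- c) ℚ.+ (b ℚ.- d)
    rearrange = solve 4 (λ a b c d → (a :+ b) :- (c :+ d) := (a :- c) :+ (b :- d)) refl
      where open +-*-Solver
    close : ∀ m n → M ℕ.⊔ N ℕ.≤ m → M ℕ.⊔ N ℕ.≤ n →
            ℚ.∣ (x m ℚ.+ y m) ℚ.- (x n ℚ.+ y n) ∣ ℚ.< ε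
    close m n ≤m ≤n = begin-strict
      ℚ.∣ (x m ℚ.+ y m) ℚ.- (x n ℚ.+ y n) ∣      ≡⟨ cong ℚ.∣_∣ (rearrange (x m) (y m) (x n) (y n)) ⟩
      ℚ.∣ (x m ℚ.- x n) ℚ.+ (y m ℚ.- y n) ∣      ≤⟨ ℚ.∣p+q∣≤∣p∣+∣q∣ (x m ℚ.- x n) (y m ℚ.- y n) ⟩
      ℚ.∣ x m ℚ.- x n ∣ ℚ.+ ℚ.∣ y m ℚ.- y n ∣    <⟨ ℚ.+-mono-<
        (closeˣ m n (ℕ.m⊔n≤o⇒m≤o M N ≤m) (ℕ.m⊔n≤o⇒m≤o M N ≤n))
        (closeʸ m n (ℕ.m⊔n≤o⇒n≤o M N ≤m) (ℕ.m⊔n≤o⇒n≤o M N ≤n)) ⟩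
      ½ ℚ.* ε ℚ.+ ½ ℚ.* ε                        ≡⟨ halves ε ⟩
      ε                                          ∎

  divide : ∀ {B ε} → 0ℚ ℚ.< B → 0ℚ ℚ.< ε → ∃[ δ ] (0ℚ ℚ.< δ × B ℚ.* δ ≡ ε)
  divide {B} {ε} 0<B 0<ε = ℚ.1/ B ℚ.* ε , 0<δ , cancel
    where
    instance
      B-pos : ℚ.Positive B
      B-pos = ℚ.positive 0<B
      B≢0 : ℚ.NonZero B
      B≢0 = ℚ.pos⇒nonZero B
      B⁻¹-pos : ℚ.Positive (ℚ.1/ B)
      B⁻¹-pos = ℚ.1/pos⇒pos B
    0<δ : 0ℚ ℚ.< ℚ.1/ B ℚ.* ε
    0<δ = subst (ℚ._< ℚ.1/ B ℚ.* ε) (ℚ.*-zeroʳ (ℚ.1/ B)) (ℚ.*-monoʳ-<-pos (ℚ.1/ B) 0<ε)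
    cancel : B ℚ.* (ℚ.1/ B ℚ.* ε) ≡ ε
    cancel = trans (sym (ℚ.*-assoc B (ℚ.1/ B) ε))
                   (trans (cong (ℚ._* ε) (ℚ.*-inverseʳ B)) (ℚ.*-identityˡ ε))

  ∣p*q∣<C*η : ∀ {C p q η} → 0ℚ ℚ.< C → ℚ.∣ p ∣ ℚ.≤ C → ℚ.∣ q ∣ ℚ.< η →
              ℚ.∣ p ℚ.* q ∣ ℚ.< C ℚ.* η
  ∣p*q∣<C*η {C} {p} {q} {η} 0<C p≤C q<η = begin-strict
    ℚ.∣ p ℚ.* q ∣          ≡⟨ ℚ.∣p*q∣≡∣p∣*∣q∣ p q ⟩
    ℚ.∣ p ∣ ℚ.* ℚ.∣ q ∣    ≤⟨ ℚ.*-monoʳ-≤-nonNeg ℚ.∣ q ∣ {{ℚ.∣-∣-nonNeg q}} p≤C ⟩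
    C ℚ.* ℚ.∣ q ∣          <⟨ ℚ.*-monoʳ-<-pos C {{ℚ.positive 0<C}} q<η ⟩
    C ℚ.* η                ∎
    where open ℚ.≤-Reasoning

  *-cauchy : ∀ x y → IsCauchy x → IsCauchy y → IsCauchy (λ n → x n ℚ.* y n)
  *-cauchy x y xc yc ε 0<ε =
    let A , 0<A , K , x≤A = bound x xc
        B , 0<B , L , y≤B = bound y yc
        γ , 0<γ , Aγ≡ = divide 0<A (½-pos 0<ε)
        δ , 0<δ , Bδ≡ = divide 0<B (½-pos 0<ε)
        M , closeˣ = xc δ 0<δ
        N , closeʸ = yc γ 0<γ
        KL = K ℕ.⊔ L
        MN = M ℕ.⊔ N
    in KL ℕ.⊔ MN , λ m n ≤m ≤n →
      close A B γ δ Aγ≡ Bδ≡ (x m) (y m) (x n) (y n)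
        (∣p*q∣<C*η 0<A (x≤A m (ℕ.m⊔n≤o⇒m≤o K L (ℕ.m⊔n≤o⇒m≤o KL MN ≤m)))
          (closeʸ m n (ℕ.m⊔n≤o⇒n≤o M N (ℕ.m⊔n≤o⇒n≤o KL MN ≤m))
                      (ℕ.m⊔n≤o⇒n≤o M N (ℕ.m⊔n≤o⇒n≤o KL MN ≤n))))
        (∣p*q∣<C*η 0<B (y≤B n (ℕ.m⊔n≤o⇒n≤o K L (ℕ.m⊔n≤o⇒m≤o KL MN ≤n)))
          (closeˣ m n (ℕ.m⊔n≤o⇒m≤o M N (ℕ.m⊔n≤o⇒n≤o KL MN ≤m))
                      (ℕ.m⊔n≤o⇒m≤o M N (ℕ.m⊔n≤o⇒n≤o KL MN ≤n))))
    where
    open ℚ.≤-Reasoning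
    rearrange : ∀ a b c d → a ℚ.* b ℚ.- c ℚ.* d ≡ a ℚ.* (b ℚ.- d) ℚ.+ d ℚ.* (a ℚ.- c)
    rearrange = solve 4 (λ a b c d →
      a :* b :- c :* d := a :* (b :- d) :+ d :* (a :- c)) refl
      where open +-*-Solver
    close : ∀ A B γ δ → A ℚ.* γ ≡ ½ ℚ.* ε → B ℚ.* δ ≡ ½ ℚ.* ε → ∀ a b c d →
            ℚ.∣ a ℚ.* (b ℚ.- d) ∣ ℚ.< A ℚ.* γ → ℚ.∣ d ℚ.* (a ℚ.- c) ∣ ℚ.< B ℚ.* δ →
            ℚ.∣ a ℚ.* b ℚ.- c ℚ.* d ∣ ℚ.< ε
    close A B γ δ Aγ≡ Bδ≡ a b c d <Aγ <Bδ = begin-strict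
      ℚ.∣ a ℚ.* b ℚ.- c ℚ.* d ∣
        ≡⟨ cong ℚ.∣_∣ (rearrange a b c d) ⟩
      ℚ.∣ a ℚ.* (b ℚ.- d) ℚ.+ d ℚ.* (a ℚ.- c) ∣
        ≤⟨ ℚ.∣p+q∣≤∣p∣+∣q∣ (a ℚ.* (b ℚ.- d)) (d ℚ.* (a ℚ.- c)) ⟩
      ℚ.∣ a ℚ.* (b ℚ.- d) ∣ ℚ.+ ℚ.∣ d ℚ.* (a ℚ.- c) ∣
        <⟨ ℚ.+-mono-< <Aγ <Bδ ⟩
      A ℚ.* γ ℚ.+ B ℚ.* δ
        ≡⟨ cong₂ ℚ._+_ Aγ≡ Bδ≡ ⟩
      ½ ℚ.* ε ℚ.+ ½ ℚ.* ε
        ≡⟨ halves ε ⟩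
      ε ∎

record ℝ : Set where
  constructor mkℝ
  field
    seq    : ℕ → ℚ
    cauchy : IsCauchy seq

open ℝ public

infix 4 _≈ᴿ_ _≤ᴿ_

_≈ᴿ_ : ℝ → ℝ → Set
x ≈ᴿ y = ∀ ε → 0ℚ ℚ.< ε →
  ∃[ N ] (∀ n → N ℕ.≤ n → ℚ.∣ seq x n ℚ.- seq y n ∣ ℚ.< ε)

_≤ᴿ_ : ℝ → ℝ → Set
x ≤ᴿ y = ∀ ε → 0ℚ ℚ.< ε →
  ∃[ N ] (∀ n → N ℕ.≤ n → seq x n ℚ.≤ seq y n ℚ.+ ε)

fromℚ : ℚ → ℝ
fromℚ p = mkℝ (λ _ → p) (const-cauchy p)

0ᴿ : ℝ
0ᴿ = fromℚ 0ℚ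

ℝ-rawRing : RawRing 0ℓ 0ℓ
ℝ-rawRing = record
  { Carrier = ℝ
  ; _≈_     = _≈ᴿ_
  ; _+_     = λ x y → mkℝ (λ n → seq x n ℚ.+ seq y n) (+-cauchy (seq x) (seq y) (cauchy x) (cauchy y))
  ; _*_     = λ x y → mkℝ (λ n → seq x n ℚ.* seq y n) (*-cauchy (seq x) (seq y) (cauchy x) (cauchy y))
  ; -_      = λ x → mkℝ (λ n → ℚ.- seq x n) (neg-cauchy (seq x) (cauchy x))
  ; 0#      = 0ᴿ
  ; 1#      = fromℚ 1ℚ
  }

------------------------------------------------------------------------
-- Polynomials in q: lists of coefficients, constant term first. Trailing
-- zeros are allowed, so equality is equality of all coefficients.

module Polynomial {c ℓ} (R : RawRing c ℓ) where
  open RawRing R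

  Poly : Set c
  Poly = List Carrier

  coeff : Poly → ℕ → Carrier
  coeff []      i       = 0#
  coeff (a ∷ f) zero    = a
  coeff (a ∷ f) (suc i) = coeff f i

  addP : Poly → Poly → Poly
  addP []      g       = g
  addP f@(_ ∷ _) []    = f
  addP (a ∷ f) (b ∷ g) = (a + b) ∷ addP f g

  -- (a + q f) g = a g + q (f g)
  mulP : Poly → Poly → Poly
  mulP []      g = []
  mulP (a ∷ f) g = addP (map (a *_) g) (0# ∷ mulP f g)

  polyRawRing : RawRing c ℓ
  polyRawRing = record
    { Carrier = Poly
    ; _≈_     = λ f g → ∀ i → coeff f i ≈ coeff g i
    ; _+_     = addP
    ; _*_     = mulP
    ; -_      = map (-_)
    ; 0#      = []
    ; 1#      = 1# ∷ []
    }

------------------------------------------------------------------------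
-- Determinants and the matrix defined by the recurrence, over any ring

module Matrix {c ℓ} (R : RawRing c ℓ) where
  open RawRing R
  open RawMonoid +-rawMonoid using (sum)

  alternate : ∀ {n} → Fin n → Carrier → Carrier
  alternate zero    x = x
  alternate (suc j) x = - alternate j x

  -- Laplace expansion along the first row; punchIn j enumerates, in order,
  -- the columns other than j.
  det : ∀ {n} → (Fin n → Fin n → Carrier) → Carrier
  det {zero}  M = 1#
  det {suc n} M = sum λ j →
    alternate j (M zero j * det (λ i k → M (suc i) (punchIn j k)))

  -- r and t are sequences indexed from 1: r 0 and t 0 are never used. Row 0
  -- is forced by triangularity, and the recurrence then makes every
  -- entry above the diagonal zero.
  recMatrix : (r s t : ℕ → Carrier) → ℕ → ℕ → Carrier
  recMatrix r s t zero    zero    = 1#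
  recMatrix r s t zero    (suc k) = 0#
  recMatrix r s t (suc n) zero    =
    s 0 * recMatrix r s t n 0 + t 1 * recMatrix r s t n 1
  recMatrix r s t (suc n) (suc k) =
    r (suc k) * recMatrix r s t n k
      + s (suc k) * recMatrix r s t n (suc k)
      + t (suc (suc k)) * recMatrix r s t n (suc (suc k))

------------------------------------------------------------------------
-- Real polynomials, coefficientwise order and q-total positivity

open Polynomial ℝ-rawRing public using (Poly; coeff; polyRawRing)
open RawRing polyRawRing public using ()
  renaming (_≈_ to _≈ᴾ_; _+_ to _+ᴾ_; _*_ to _*ᴾ_; -_ to -ᴾ_; 0# to 0ᴾ; 1# to 1ᴾ)
open Matrix polyRawRing public using (det; recMatrix)

NonNegCoeffs : Poly → Set
NonNegCoeffs f = ∀ i → 0ᴿ ≤ᴿ coeff f i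

infix 4 _≥q_

_≥q_ : Poly → Poly → Set
f ≥q g = NonNegCoeffs (f +ᴾ (-ᴾ g))

-- A minor is given by strictly increasing choices of rows and columns.
q-TP : (ℕ → ℕ → Poly) → Set
q-TP A = ∀ n (rows cols : Fin n → ℕ) →
  rows Preserves Fin._<_ ⟶ ℕ._<_ → cols Preserves Fin._<_ ⟶ ℕ._<_ →
  NonNegCoeffs (det λ i j → A (rows i) (cols j))

{-# OPTIONS --safe #-}
module Submission where

-- Let J be the tridiagonal matrix with r on the superdiagonal, s on the
-- diagonal and t on the subdiagonal.  The recurrence says that rows
-- 1, 2, ... of A are A J, while row 0 of A is the unit vector.  Each of the
-- three conditions provides sequences d, α, β, γ, δ with nonnegative
-- coefficients such that
--   r (k+1) = β k δ k,   t (k+1) = α k γ k,   s 0 = d 0 + β 0 γ 0,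
--   s (k+1) = d (k+1) + α k δ k + β (k+1) γ (k+1),
-- d being the slack of the inequality on s; the choices are
--   (i) γ = δ = 1,   (ii) α = β = 1,   (iii) β = γ = 1.
-- This is a factorisation J = L R through an index set that interleaves one
-- new index between any two consecutive old ones: the index 2k carries the
-- diagonal term d k, and the index 2k+1 carries the product of the column
-- (β k , α k) and the row (γ k , δ k) on the old indices k and k+1.  An old
-- index k meets only 2k-1, 2k and 2k+1, so in L and in R alike the supports of
-- successive columns are weakly ordered.
--
-- Multiplication on the right by such a matrix preserves nonnegativity of
-- minors (staircase): expand the columns of a minor of X L multilinearly
-- into columns of X.  Every term is a nonnegative multiple of a determinant
-- whose columns are columns of X taken in weakly increasing order.  Either
-- two neighbouring columns coincide and the determinant vanishes
-- (det-adjacent), or the order is strict and it is a minor of X.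
--
-- Let E be A L with the unit vector put on top as row 0.  Then A = E R, so
-- the minors of A reduce to minors of E on the same rows.  Row 0 can be
-- expanded away from a minor of E, and the minors of E on positive rows
-- reduce to minors of A on rows with smaller indices.  This is an induction
-- on a bound for the row indices (E-minors).
--
-- The argument uses only a commutative ring with a set of "nonnegative"
-- elements that contains 0 and 1 and is closed under sums and products.
-- It is applied to the real polynomials; that products of nonnegative reals
-- are nonnegative is seen from: x is nonnegative iff the sequence x - |x|
-- tends to zero.

open import Algebra.Bundles using (CommutativeRing)
open import Algebra.Bundles.Raw using (RawRing)
import Algebra.Definitions.RawMonoid as RawMonoid
import Algebra.Properties.CommutativeMonoid.Sum as Sum
import Algebra.Properties.Ring as RingProperties
import Algebra.Properties.Semiring.Sum as SemiringSum
import Algebra.Solver.Ring.NaturalCoefficients.Default as NaturalSolver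
open import Data.Empty using (⊥-elim)
open import Data.Fin.Base as Fin using (Fin; zero; suc; inject₁; punchIn; punchOut)
import Data.Fin.Properties as Fin
open import Data.List.Base using (List; []; _∷_; map)
open import Data.List.Relation.Unary.All using (All; []; _∷_)
open import Data.Nat.Base as ℕ using (ℕ; zero; suc; z≤n; s≤s; z<s; s<s; pred; _≥_)
import Data.Nat.Properties as ℕ
open import Data.Product.Base using (_×_; _,_; ∃-syntax)
open import Data.Rational.Base as ℚ using (ℚ; 0ℚ; ½; 1ℚ)
import Data.Rational.Properties as ℚ
open import Data.Rational.Solver using (module +-*-Solver)
open import Data.Sum.Base using (_⊎_; inj₁; inj₂)
open import Data.Vec.Base using (Vec; []; _∷_; lookup; tabulate; _[_]≔_)
import Data.Vec.Properties as Vec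
open import Function.Base using (_∘_)
open import Level using (_⊔_)
open import Relation.Binary.Core using (_Preserves_⟶_)
open import Relation.Binary.PropositionalEquality as ≡ using (_≡_; _≢_; refl; cong; subst)
open import Relation.Binary.Structures using (IsEquivalence)
open import Relation.Nullary.Decidable.Core using (yes; no)

open import Defs hiding (det; recMatrix; Poly; coeff; polyRawRing)

------------------------------------------------------------------------
-- Determinants as alternating multilinear functions of the columns

module Determinant {c ℓ} (R : CommutativeRing c ℓ) where
  open CommutativeRing R hiding (zero) renaming (refl to ≈-refl; sym to ≈-sym; trans to ≈-trans)
  open Matrix rawRing using (alternate; det) public
  open RawMonoid +-rawMonoid using (sum)
  open Sum +-commutativeMonoid using (sum-cong-≋; ∑-distrib-+; sum-replicate-zero)
  open SemiringSum semiring using (*-distribˡ-sum)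
  open RingProperties ring using (-0#≈0#; -‿distribʳ-*; -‿+-comm)
  open NaturalSolver commutativeSemiring using (solve; _:=_; _:+_; _:*_)
  open import Relation.Binary.Reasoning.Setoid setoid

  SquareMatrix : ℕ → Set c
  SquareMatrix n = Fin n → Fin n → Carrier

  alternate-cong : ∀ {n} (j : Fin n) {x y} → x ≈ y → alternate j x ≈ alternate j y
  alternate-cong zero    x≈y = x≈y
  alternate-cong (suc j) x≈y = -‿cong (alternate-cong j x≈y)

  alternate-+ : ∀ {n} (j : Fin n) x y → alternate j (x + y) ≈ alternate j x + alternate j y
  alternate-+ zero    x y = ≈-refl
  alternate-+ (suc j) x y = ≈-trans (-‿cong (alternate-+ j x y)) (≈-sym (-‿+-comm _ _))

  alternate-* : ∀ {n} (j : Fin n) a x → alternate j (a * x) ≈ a * alternate j x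
  alternate-* zero    a x = ≈-refl
  alternate-* (suc j) a x = ≈-trans (-‿cong (alternate-* j a x)) (-‿distribʳ-* a _)

  alternate-0 : ∀ {n} (j : Fin n) {x} → x ≈ 0# → alternate j x ≈ 0#
  alternate-0 zero    x≈0 = x≈0
  alternate-0 (suc j) x≈0 = ≈-trans (-‿cong (alternate-0 j x≈0)) -0#≈0#

  alternate-inject₁ : ∀ {n} (j : Fin n) x → alternate (inject₁ j) x ≡ alternate j x
  alternate-inject₁ zero    x = refl
  alternate-inject₁ (suc j) x = cong -_ (alternate-inject₁ j x)

  sum-0 : ∀ {n} {f : Fin n → Carrier} → (∀ j → f j ≈ 0#) → sum f ≈ 0#
  sum-0 {n} f≈0 = ≈-trans (sum-cong-≋ f≈0) (sum-replicate-zero n)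

  det-cong : ∀ {n} {M N : SquareMatrix n} → (∀ i j → M i j ≈ N i j) → det M ≈ det N
  det-cong {zero}  M≈N = ≈-refl
  det-cong {suc n} M≈N = sum-cong-≋ λ j → alternate-cong j
    (*-cong (M≈N zero j) (det-cong λ i k → M≈N (suc i) (punchIn j k)))

  det-firstRow : ∀ {n} (M : SquareMatrix (suc n)) → (∀ j → M zero (suc j) ≈ 0#) →
                 det M ≈ M zero zero * det (λ i k → M (suc i) (suc k))
  det-firstRow M row≈0 = ≈-trans (+-congˡ (sum-0 λ j → alternate-0 (suc j)
    (≈-trans (*-congʳ (row≈0 j)) (zeroˡ _)))) (+-identityʳ _)

  -- Linearity in column k: the three matrices agree in all other columns.
  det-linear : ∀ {n} a b {M M′ M″ : SquareMatrix n} k →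
               (∀ i → M i k ≈ a * M′ i k + b * M″ i k) →
               (∀ i j → j ≢ k → M i j ≈ M′ i j) →
               (∀ i j → j ≢ k → M i j ≈ M″ i j) →
               det M ≈ a * det M′ + b * det M″
  det-linear {suc n} a b {M} {M′} {M″} k atk off′ off″ = begin
    sum T                                      ≈⟨ sum-cong-≋ term ⟩
    sum (λ j → a * T′ j + b * T″ j)            ≈⟨ ∑-distrib-+ (λ j → a * T′ j) (λ j → b * T″ j) ⟩
    sum (λ j → a * T′ j) + sum (λ j → b * T″ j)
      ≈⟨ +-cong (*-distribˡ-sum a T′) (*-distribˡ-sum b T″) ⟨
    a * sum T′ + b * sum T″                    ∎
    where
    minor : SquareMatrix (suc n) → Fin (suc n) → SquareMatrix n
    minor N j i l = N (suc i) (punchIn j l)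
    summand : SquareMatrix (suc n) → Fin (suc n) → Carrier
    summand N j = alternate j (N zero j * det (minor N j))
    T  = summand M
    T′ = summand M′
    T″ = summand M″
    combine : ∀ j {x y z} → x ≈ a * y + b * z →
              alternate j x ≈ a * alternate j y + b * alternate j z
    combine j {x} {y} {z} eq = begin
      alternate j x                              ≈⟨ alternate-cong j eq ⟩
      alternate j (a * y + b * z)                ≈⟨ alternate-+ j _ _ ⟩
      alternate j (a * y) + alternate j (b * z)  ≈⟨ +-cong (alternate-* j a y) (alternate-* j b z) ⟩
      a * alternate j y + b * alternate j z      ∎
    term : ∀ j → T j ≈ a * T′ j + b * T″ j
    -- Column k enters the summand of j through the entry of the first row if
    -- j = k, and through the minor otherwise.
    term j with j Fin.≟ k
    ... | yes refl = combine j (begin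
      M zero j * D                              ≈⟨ *-congʳ (atk zero) ⟩
      (a * M′ zero j + b * M″ zero j) * D       ≈⟨ solve 5 (λ a b x y d →
        (a :* x :+ b :* y) :* d := a :* (x :* d) :+ b :* (y :* d)) ≈-refl a b _ _ D ⟩
      a * (M′ zero j * D) + b * (M″ zero j * D)
        ≈⟨ +-cong (*-congˡ (*-congˡ (det-cong λ i l → off′ (suc i) (punchIn j l) (Fin.punchInᵢ≢i j l))))
                  (*-congˡ (*-congˡ (det-cong λ i l → off″ (suc i) (punchIn j l) (Fin.punchInᵢ≢i j l)))) ⟩
      a * (M′ zero j * det (minor M′ j)) + b * (M″ zero j * det (minor M″ j)) ∎)
      where D = det (minor M j)
    ... | no j≢k = combine j (begin
      M zero j * det (minor M j)                ≈⟨ *-congˡ (det-linear a b l atl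
        (λ i m m≢l → off′ (suc i) (punchIn j m) (avoid m m≢l))
        (λ i m m≢l → off″ (suc i) (punchIn j m) (avoid m m≢l))) ⟩
      M zero j * (a * D′ + b * D″)              ≈⟨ solve 5 (λ a b x d′ d″ →
        x :* (a :* d′ :+ b :* d″) := a :* (x :* d′) :+ b :* (x :* d″)) ≈-refl a b _ D′ D″ ⟩
      a * (M zero j * D′) + b * (M zero j * D″)
        ≈⟨ +-cong (*-congˡ (*-congʳ (off′ zero j j≢k))) (*-congˡ (*-congʳ (off″ zero j j≢k))) ⟩
      a * (M′ zero j * D′) + b * (M″ zero j * D″) ∎)
      where
      D′ = det (minor M′ j)
      D″ = det (minor M″ j)
      l = punchOut j≢k
      l↦k : punchIn j l ≡ k
      l↦k = Fin.punchIn-punchOut j≢k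
      atl : ∀ i → minor M j i l ≈ a * minor M′ j i l + b * minor M″ j i l
      atl i rewrite l↦k = atk (suc i)
      avoid : ∀ m → m ≢ l → punchIn j m ≢ k
      avoid m m≢l eq = m≢l (Fin.punchIn-injective j m l (≡.trans eq (≡.sym l↦k)))

  -- A sum is zero if two neighbouring terms cancel and all others vanish.
  sum-adjacent : ∀ {n} (f : Fin (suc (suc n)) → Carrier) (k : Fin (suc n)) →
                 f (inject₁ k) + f (suc k) ≈ 0# →
                 (∀ j → j ≢ inject₁ k → j ≢ suc k → f j ≈ 0#) → sum f ≈ 0#
  sum-adjacent f zero cancel rest = begin
    f zero + (f (suc zero) + sum (λ j → f (suc (suc j))))  ≈⟨ +-assoc _ _ _ ⟨
    (f zero + f (suc zero)) + sum (λ j → f (suc (suc j)))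
      ≈⟨ +-cong cancel (sum-0 λ j → rest (suc (suc j)) (λ ()) (λ ())) ⟩
    0# + 0#                                                ≈⟨ +-identityˡ 0# ⟩
    0#                                                     ∎
  sum-adjacent {suc n} f (suc k) cancel rest = ≈-trans
    (+-cong (rest zero (λ ()) (λ ()))
            (sum-adjacent (λ j → f (suc j)) k cancel
              λ j j≢ j≢′ → rest (suc j) (j≢ ∘ Fin.suc-injective) (j≢′ ∘ Fin.suc-injective)))
    (+-identityˡ 0#)

  -- Neighbouring columns stay neighbours when a third column is deleted.
  punchIn-adjacent : ∀ {n} (j : Fin (suc (suc n))) (k : Fin (suc n)) →
                     j ≢ inject₁ k → j ≢ suc k →
                     ∃[ l ] (punchIn j (inject₁ l) ≡ inject₁ k × punchIn j (suc l) ≡ suc k)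
  punchIn-adjacent zero          zero    j≢ j≢′ = ⊥-elim (j≢ refl)
  punchIn-adjacent {suc n} zero  (suc k) j≢ j≢′ = k , refl , refl
  punchIn-adjacent (suc zero)    zero    j≢ j≢′ = ⊥-elim (j≢′ refl)
  punchIn-adjacent {suc n} (suc (suc j)) zero j≢ j≢′ = zero , refl , refl
  punchIn-adjacent {suc n} (suc j) (suc k) j≢ j≢′
    with l , eq , eq′ ← punchIn-adjacent j k (j≢ ∘ cong suc) (j≢′ ∘ cong suc)
    = suc l , cong suc eq , cong suc eq′

  -- Deleting either of two equal neighbouring entries gives the same result.
  punchIn-swap : ∀ {n} (v : Fin (suc n) → Carrier) (k : Fin n) → v (inject₁ k) ≈ v (suc k) →
                 ∀ l → v (punchIn (inject₁ k) l) ≈ v (punchIn (suc k) l)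
  punchIn-swap v zero    eq zero    = ≈-sym eq
  punchIn-swap v zero    eq (suc l) = ≈-refl
  punchIn-swap v (suc k) eq zero    = ≈-refl
  punchIn-swap v (suc k) eq (suc l) = punchIn-swap (v ∘ suc) k eq l

  -- The determinant vanishes if two neighbouring columns are equal: deleting
  -- one or the other gives equal minors, which occur with opposite signs.
  det-adjacent : ∀ {n} (M : SquareMatrix (suc n)) (k : Fin n) →
                 (∀ i → M i (inject₁ k) ≈ M i (suc k)) → det M ≈ 0#
  det-adjacent {suc n} M k eq = sum-adjacent _ k cancel vanish
    where
    cancel : alternate (inject₁ k) (M zero (inject₁ k) * det (λ i l → M (suc i) (punchIn (inject₁ k) l)))
             + alternate (suc k) (M zero (suc k) * det (λ i l → M (suc i) (punchIn (suc k) l))) ≈ 0#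
    cancel = begin
      alternate (inject₁ k) _ + alternate (suc k) _
        ≈⟨ +-congʳ (≈-trans (reflexive (alternate-inject₁ k _))
             (alternate-cong k (*-cong (eq zero)
               (det-cong λ i l → punchIn-swap (M (suc i)) k (eq (suc i)) l)))) ⟩
      alternate k _ + - alternate k _           ≈⟨ -‿inverseʳ _ ⟩
      0#                                        ∎
    vanish : ∀ j → j ≢ inject₁ k → j ≢ suc k → alternate j (M zero j * det (λ i l → M (suc i) (punchIn j l))) ≈ 0#
    vanish j j≢ j≢′ with l , e , e′ ← punchIn-adjacent j k j≢ j≢′ =
      alternate-0 j (≈-trans (*-congˡ (det-adjacent (λ i m → M (suc i) (punchIn j m)) l λ i →
        ≈-trans (reflexive (cong (M (suc i)) e))
          (≈-trans (eq (suc i)) (reflexive (cong (M (suc i)) (≡.sym e′)))))) (zeroʳ _))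

------------------------------------------------------------------------
-- Monotone sequences of indices

StrictlyIncreasing : ∀ {n} → (Fin n → ℕ) → Set
StrictlyIncreasing f = f Preserves Fin._<_ ⟶ ℕ._<_

strictlyIncreasing : ∀ {n} (f : Fin (suc n) → ℕ) →
                     (∀ k → f (inject₁ k) ℕ.< f (suc k)) → StrictlyIncreasing f
strictlyIncreasing f step {zero}  {suc zero}    _ = step zero
strictlyIncreasing f step {zero}  {suc (suc j)} _ =
  ℕ.<-trans (step zero) (strictlyIncreasing (f ∘ suc) (step ∘ suc) {zero} {suc j} z<s)
strictlyIncreasing {suc n} f step {suc i} {suc j} (s<s i<j) =
  strictlyIncreasing (f ∘ suc) (step ∘ suc) {i} {j} i<j

inject₁<suc : ∀ {n} (k : Fin n) → inject₁ k Fin.< suc k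
inject₁<suc zero    = z<s
inject₁<suc (suc k) = s<s (inject₁<suc k)

strict-or-stationary : ∀ {n} (f : Fin (suc n) → ℕ) → (∀ {i j} → i Fin.< j → f i ℕ.≤ f j) →
                       StrictlyIncreasing f ⊎ ∃[ k ] (f (inject₁ k) ≡ f (suc k))
strict-or-stationary f mono with Fin.any? (λ k → f (inject₁ k) ℕ.≟ f (suc k))
... | yes stationary = inj₂ stationary
... | no  strict     = inj₁ (strictlyIncreasing f λ k →
  ℕ.≤∧≢⇒< (mono (inject₁<suc k)) (λ eq → strict (k , eq)))

strictlyBounded : ∀ {n} (f : Fin n → ℕ) → ∃[ N ] (∀ i → f i ℕ.< N)
strictlyBounded {zero}  f = 0 , λ ()
strictlyBounded {suc n} f with N , bound ← strictlyBounded (f ∘ suc) =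
  suc (f zero ℕ.⊔ N) , λ where
    zero    → s≤s (ℕ.m≤m⊔n (f zero) N)
    (suc i) → s≤s (ℕ.≤-trans (ℕ.<⇒≤ (bound i)) (ℕ.m≤n⊔m (f zero) N))

------------------------------------------------------------------------
-- Interleaving two copies of the natural numbers

double : ℕ → ℕ
double zero    = zero
double (suc k) = suc (suc (double k))

double-mono : ∀ {k l} → k ℕ.≤ l → double k ℕ.≤ double l
double-mono z≤n     = z≤n
double-mono (s≤s p) = s≤s (s≤s (double-mono p))

halve-≤ : ∀ {k l} → double k ℕ.≤ suc (double l) → k ℕ.≤ l
halve-≤ {zero}          _ = z≤n
halve-≤ {suc k} {suc l} (s≤s (s≤s p)) = s≤s (halve-≤ p)

-- m is one of 2k-1, 2k and 2k+1, stated without subtraction.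
Near : ℕ → ℕ → Set
Near m k = m ℕ.≤ suc (double k) × double k ℕ.≤ suc m

-- Near is a staircase in both directions: the supports of successive rows,
-- and likewise of successive columns, overlap in at most one end point.
near-monoˡ : ∀ {m m′ k k′} → Near m k → Near m′ k′ → m ℕ.< m′ → k ℕ.≤ k′
near-monoˡ (_ , 2k≤) (m′≤ , _) m<m′ = halve-≤ (ℕ.≤-trans 2k≤ (ℕ.≤-trans m<m′ m′≤))

near-monoʳ : ∀ {m m′ k k′} → Near m k → Near m′ k′ → k ℕ.< k′ → m ℕ.≤ m′
near-monoʳ (m≤ , _) (_ , 2k′≤) k<k′ =
  ℕ.≤-trans m≤ (ℕ.s≤s⁻¹ (ℕ.≤-trans (double-mono k<k′) 2k′≤))

near-below : ∀ k → Near (suc (double k)) (suc k)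
near-below k = s≤s (ℕ.≤-trans (ℕ.n≤1+n _) (ℕ.n≤1+n _)) , ℕ.≤-refl

near-at : ∀ k → Near (double k) k
near-at k = ℕ.n≤1+n _ , ℕ.n≤1+n _

near-above : ∀ k → Near (suc (double k)) k
near-above k = ℕ.≤-refl , ℕ.≤-trans (ℕ.n≤1+n _) (ℕ.n≤1+n _)

-- The sequence f 0, g 0, f 1, g 1, ...
interleave : ∀ {a} {A : Set a} → (ℕ → A) → (ℕ → A) → ℕ → A
interleave f g zero          = f zero
interleave f g (suc zero)    = g zero
interleave f g (suc (suc m)) = interleave (f ∘ suc) (g ∘ suc) m

interleave-even : ∀ {a} {A : Set a} (f g : ℕ → A) k → interleave f g (double k) ≡ f k
interleave-even f g zero    = refl
interleave-even f g (suc k) = interleave-even (f ∘ suc) (g ∘ suc) k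

interleave-odd : ∀ {a} {A : Set a} (f g : ℕ → A) k → interleave f g (suc (double k)) ≡ g k
interleave-odd f g zero    = refl
interleave-odd f g (suc k) = interleave-odd (f ∘ suc) (g ∘ suc) k

interleave-elim : ∀ {a q} {A : Set a} (Q : ℕ → A → Set q) (f g : ℕ → A) →
                  (∀ k → Q (double k) (f k)) → (∀ k → Q (suc (double k)) (g k)) →
                  ∀ m → Q m (interleave f g m)
interleave-elim Q f g even odd zero          = even zero
interleave-elim Q f g even odd (suc zero)    = odd zero
interleave-elim Q f g even odd (suc (suc m)) =
  interleave-elim (λ m → Q (suc (suc m))) (f ∘ suc) (g ∘ suc) (even ∘ suc) (odd ∘ suc) m

------------------------------------------------------------------------
-- Staircase matrices preserve nonnegative minors

-- The predicate P on a commutative ring is closed like the set of nonnegative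
-- elements; it need not be salient, nor come from a total order.
record IsPositiveCone {c ℓ p} (R : CommutativeRing c ℓ)
                      (P : CommutativeRing.Carrier R → Set p) : Set (c ⊔ ℓ ⊔ p) where
  open CommutativeRing R using (Carrier; _≈_; _+_; _*_; 0#; 1#)
  field
    P-resp : ∀ {x y} → x ≈ y → P x → P y
    P-0    : P 0#
    P-1    : P 1#
    P-+    : ∀ {x y} → P x → P y → P (x + y)
    P-*    : ∀ {x y} → P x → P y → P (x * y)

module TotalPositivity {c ℓ p} (R : CommutativeRing c ℓ)
                       (P : CommutativeRing.Carrier R → Set p) (cone : IsPositiveCone R P) where
  open CommutativeRing R hiding (zero) renaming (refl to ≈-refl; sym to ≈-sym; trans to ≈-trans)
  open Matrix rawRing using (recMatrix)
  open Determinant R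
  open IsPositiveCone cone
  open NaturalSolver commutativeSemiring using (solve; _:=_; _:+_; _:*_; con)
  open import Relation.Binary.Reasoning.Setoid setoid

  -- All minors of X with the given rows lie in P.
  PositiveMinors : ∀ {n} → (Fin n → ℕ) → (ℕ → ℕ → Carrier) → Set p
  PositiveMinors {n} rows X =
    ∀ cols → StrictlyIncreasing cols → P (det {n} λ i j → X (rows i) (cols j))

  -- A formal linear combination of the columns of a matrix: pairs of a weight
  -- and a column index.  Its value on a row x is the weighted sum of entries.
  Combination : Set c
  Combination = List (Carrier × ℕ)

  ⟦_⟧ : Combination → (ℕ → Carrier) → Carrier
  ⟦ []          ⟧ x = 0#
  ⟦ (w , k) ∷ L ⟧ x = w * x k + ⟦ L ⟧ x

  unit : ℕ → Combination
  unit k = (1# , k) ∷ []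

  ⟦unit⟧ : ∀ k x → ⟦ unit k ⟧ x ≈ x k
  ⟦unit⟧ k x = ≈-trans (+-identityʳ _) (*-identityˡ _)

  -- All weights lie in P, and all column indices lie in the support S.
  PositiveOn : ∀ {q} → (ℕ → Set q) → Combination → Set _
  PositiveOn S = All λ (w , k) → P w × S k

  -- Multilinear expansion of a function of n combinations: it takes values in
  -- P as soon as it does so whenever each combination is a single column in
  -- the respective support.  Additivity is asked only in the form needed for
  -- a recursion over the terms of each combination.
  expand : ∀ {n q} (Φ : Vec Combination n → Carrier) →
    (∀ Ls j → Φ (Ls [ j ]≔ []) ≈ 0#) →
    (∀ Ls j w k L → Φ (Ls [ j ]≔ ((w , k) ∷ L)) ≈ w * Φ (Ls [ j ]≔ unit k) + Φ (Ls [ j ]≔ L)) →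
    (S : Fin n → ℕ → Set q) →
    (∀ ks → (∀ j → S j (ks j)) → P (Φ (tabulate (unit ∘ ks)))) →
    ∀ Ls → (∀ j → PositiveOn (S j) (lookup Ls j)) → P (Φ Ls)
  expand {zero} Φ nil cons S leaf [] pos = leaf (λ ()) (λ ())
  expand {suc n} Φ nil cons S leaf (L ∷ Ls) pos = column L (pos zero)
    where
    column : ∀ L → PositiveOn (S zero) L → P (Φ (L ∷ Ls))
    column []            []                   = P-resp (≈-sym (nil ([] ∷ Ls) zero)) P-0
    column ((w , k) ∷ L) ((pw , Sk) ∷ pL) =
      P-resp (≈-sym (cons ([] ∷ Ls) zero w k L)) (P-+ (P-* pw rest) (column L pL))
      where
      rest : P (Φ (unit k ∷ Ls))
      rest = expand (λ Ls → Φ (unit k ∷ Ls))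
        (λ Ls j → nil (unit k ∷ Ls) (suc j))
        (λ Ls j → cons (unit k ∷ Ls) (suc j))
        (S ∘ suc)
        (λ ks Sks → leaf (λ { zero → k ; (suc j) → ks j })
                         (λ { zero → Sk ; (suc j) → Sks j }))
        Ls (pos ∘ suc)

  -- Let column c of a matrix be the combination L c of the columns of X.  If
  -- the weights are in P and the supports of the L c are weakly increasing
  -- with c, then the minors stay in P.
  staircase : ∀ {q} (L : ℕ → Combination) (S : ℕ → ℕ → Set q) →
    (∀ c → PositiveOn (S c) (L c)) →
    (∀ {c c′ k k′} → S c k → S c′ k′ → c ℕ.< c′ → k ℕ.≤ k′) →
    ∀ {n} (rows : Fin n → ℕ) X →
    PositiveMinors rows X → PositiveMinors rows (λ i c → ⟦ L c ⟧ (X i))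
  staircase L S pos mono {zero} rows X TP cols inc = P-1
  staircase L S pos mono {suc n} rows X TP cols inc =
    P-resp (det-cong λ i j → reflexive (cong (λ L → ⟦ L ⟧ (X (rows i))) (Vec.lookup∘tabulate (L ∘ cols) j)))
      (expand Φ nil cons (S ∘ cols) leaf (tabulate (L ∘ cols))
        (λ j → subst (PositiveOn _) (≡.sym (Vec.lookup∘tabulate (L ∘ cols) j)) (pos (cols j))))
    where
    M : Vec Combination (suc n) → SquareMatrix (suc n)
    M Ls i j = ⟦ lookup Ls j ⟧ (X (rows i))
    Φ : Vec Combination (suc n) → Carrier
    Φ Ls = det (M Ls)
    at : ∀ Ls j L i → M (Ls [ j ]≔ L) i j ≡ ⟦ L ⟧ (X (rows i))
    at Ls j L i = cong (λ L → ⟦ L ⟧ (X (rows i))) (Vec.lookup∘update j Ls L)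
    off : ∀ Ls j L L′ i m → m ≢ j → M (Ls [ j ]≔ L) i m ≈ M (Ls [ j ]≔ L′) i m
    off Ls j L L′ i m m≢j = reflexive (cong (λ L → ⟦ L ⟧ (X (rows i)))
      (≡.trans (Vec.lookup∘update′ m≢j Ls L) (≡.sym (Vec.lookup∘update′ m≢j Ls L′))))
    nil : ∀ Ls j → Φ (Ls [ j ]≔ []) ≈ 0#
    -- A zero column is 0 times itself plus 0 times itself.
    nil Ls j = begin
      Φ Ls₀                     ≈⟨ det-linear 0# 0# {M′ = M Ls₀} {M″ = M Ls₀} j
        (λ i → ≈-trans (reflexive (at Ls j [] i)) (≈-sym (zeros _ _)))
        (λ i m _ → ≈-refl) (λ i m _ → ≈-refl) ⟩
      0# * Φ Ls₀ + 0# * Φ Ls₀   ≈⟨ zeros _ _ ⟩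
      0#                        ∎
      where
      Ls₀ = Ls [ j ]≔ []
      zeros : ∀ x y → 0# * x + 0# * y ≈ 0#
      zeros x y = ≈-trans (+-cong (zeroˡ x) (zeroˡ y)) (+-identityˡ 0#)
    cons : ∀ Ls j w k L → Φ (Ls [ j ]≔ ((w , k) ∷ L)) ≈ w * Φ (Ls [ j ]≔ unit k) + Φ (Ls [ j ]≔ L)
    cons Ls j w k L = ≈-trans
      (det-linear w 1# {M′ = M (Ls [ j ]≔ unit k)} {M″ = M (Ls [ j ]≔ L)} j
        (λ i → ≈-trans (reflexive (at Ls j ((w , k) ∷ L) i)) (≈-sym (+-cong
          (*-congˡ (≈-trans (reflexive (at Ls j (unit k) i)) (⟦unit⟧ k (X (rows i)))))
          (≈-trans (*-identityˡ _) (reflexive (at Ls j L i))))))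
        (off Ls j _ _) (off Ls j _ _))
      (+-congˡ (*-identityˡ _))
    leaf : ∀ ks → (∀ j → S (cols j) (ks j)) → P (Φ (tabulate (unit ∘ ks)))
    leaf ks Sks = P-resp (≈-sym (det-cong λ i j → ≈-trans
        (reflexive (cong (λ L → ⟦ L ⟧ (X (rows i))) (Vec.lookup∘tabulate (unit ∘ ks) j)))
        (⟦unit⟧ (ks j) (X (rows i)))))
      minor
      where
      minor : P (det λ i j → X (rows i) (ks j))
      minor with strict-or-stationary ks (λ {i} {j} i<j → mono (Sks i) (Sks j) (inc i<j))
      ... | inj₁ strict    = TP ks strict
      ... | inj₂ (k , eq) = P-resp (≈-sym (det-adjacent (λ i j → X (rows i) (ks j)) k λ i → reflexive (cong (X (rows i)) eq))) P-0

  ----------------------------------------------------------------------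
  -- The matrix of a recurrence whose tridiagonal matrix factors

  -- The five sequences d, α, β, γ and δ encode the factorisation J = L R of
  -- the tridiagonal matrix J with entries r, s and t.
  module Factored
    (d α β γ δ : ℕ → Carrier)
    (d≥0 : ∀ k → P (d k)) (α≥0 : ∀ k → P (α k)) (β≥0 : ∀ k → P (β k))
    (γ≥0 : ∀ k → P (γ k)) (δ≥0 : ∀ k → P (δ k))
    (r s t : ℕ → Carrier)
    (r≈ : ∀ k → r (suc k) ≈ β k * δ k)
    (t≈ : ∀ k → t (suc k) ≈ α k * γ k)
    (s₀≈ : s 0 ≈ d 0 + β 0 * γ 0)
    (s≈ : ∀ k → s (suc k) ≈ d (suc k) + (α k * δ k + β (suc k) * γ (suc k)))
    where

    A : ℕ → ℕ → Carrier
    A = recMatrix r s t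

    -- Column m of the left factor L and column k of the right factor R.  The
    -- columns 2k and 2k+1 of L are given by evens k and odds k.  Column k of R
    -- has entries in rows 2k-1, 2k and 2k+1, the first being absent for k = 0.
    evens odds left right : ℕ → Combination
    evens k = (d k , k) ∷ []
    odds  k = (β k , k) ∷ (α k , suc k) ∷ []
    left  m = interleave evens odds m

    right zero    = (1# , 0) ∷ (γ 0 , 1) ∷ []
    right (suc k) = (δ k , suc (double k)) ∷ (1# , double (suc k)) ∷ (γ (suc k) , suc (double (suc k))) ∷ []

    left-positive : ∀ m → PositiveOn (Near m) (left m)
    left-positive = interleave-elim (λ m → PositiveOn (Near m)) evens odds
      (λ k → (d≥0 k , near-at k) ∷ [])
      (λ k → (β≥0 k , near-above k) ∷ (α≥0 k , near-below k) ∷ [])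

    right-positive : ∀ k → PositiveOn (λ m → Near m k) (right k)
    right-positive zero    = (P-1 , near-at 0) ∷ (γ≥0 0 , near-above 0) ∷ []
    right-positive (suc k) =
      (δ≥0 k , near-below k) ∷ (P-1 , near-at (suc k)) ∷ (γ≥0 (suc k) , near-above (suc k)) ∷ []

    -- The matrix A L with the unit vector put on top as row 0.
    E : ℕ → ℕ → Carrier
    E zero    zero    = 1#
    E zero    (suc m) = 0#
    E (suc n) m       = ⟦ left m ⟧ (A n)

    E-even : ∀ n k → E (suc n) (double k) ≈ d k * A n k
    E-even n k = ≈-trans (reflexive (cong (λ L → ⟦ L ⟧ (A n)) (interleave-even evens odds k))) (+-identityʳ _)

    E-odd : ∀ n k → E (suc n) (suc (double k)) ≈ β k * A n k + α k * A n (suc k)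
    E-odd n k = ≈-trans (reflexive (cong (λ L → ⟦ L ⟧ (A n)) (interleave-odd evens odds k)))
      (+-congˡ (+-identityʳ _))

    -- A = E R: for positive rows this is the recurrence, with r, s and t
    -- replaced by their expressions in d, α, β, γ and δ.
    A≈ER : ∀ n k → A n k ≈ ⟦ right k ⟧ (E n)
    A≈ER zero zero = solve 1 (λ g → con 1 := con 1 :* con 1 :+ (g :* con 0 :+ con 0)) ≈-refl (γ 0)
    A≈ER zero (suc k) = solve 2 (λ d g → con 0 := d :* con 0 :+ (con 1 :* con 0 :+ (g :* con 0 :+ con 0)))
      ≈-refl (δ k) (γ (suc k))
    A≈ER (suc n) zero = begin
      s 0 * a + t 1 * a′                                  ≈⟨ +-cong (*-congʳ s₀≈) (*-congʳ (t≈ 0)) ⟩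
      (d 0 + β 0 * γ 0) * a + (α 0 * γ 0) * a′
        ≈⟨ solve 6 (λ d b g al a a′ → (d :+ b :* g) :* a :+ (al :* g) :* a′
             := con 1 :* (d :* a) :+ (g :* (b :* a :+ al :* a′) :+ con 0)) ≈-refl (d 0) (β 0) (γ 0) (α 0) a a′ ⟩
      1# * (d 0 * a) + (γ 0 * (β 0 * a + α 0 * a′) + 0#)
        ≈⟨ +-cong (*-congˡ (E-even n 0)) (+-congʳ (*-congˡ (E-odd n 0))) ⟨
      ⟦ right 0 ⟧ (E (suc n))                             ∎
      where
      a = A n 0
      a′ = A n 1
    A≈ER (suc n) (suc k) = begin
      r (suc k) * a + s (suc k) * a′ + t (suc (suc k)) * a″
        ≈⟨ +-cong (+-cong (*-congʳ (r≈ k)) (*-congʳ (s≈ k))) (*-congʳ (t≈ (suc k))) ⟩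
      (β k * δ k) * a + (d (suc k) + (α k * δ k + β (suc k) * γ (suc k))) * a′ + (α (suc k) * γ (suc k)) * a″
        ≈⟨ solve 10 (λ b dl d al b′ g al′ a a′ a″ →
             (b :* dl) :* a :+ (d :+ (al :* dl :+ b′ :* g)) :* a′ :+ (al′ :* g) :* a″
             := dl :* (b :* a :+ al :* a′) :+ (con 1 :* (d :* a′) :+ (g :* (b′ :* a′ :+ al′ :* a″) :+ con 0)))
             ≈-refl (β k) (δ k) (d (suc k)) (α k) (β (suc k)) (γ (suc k)) (α (suc k)) a a′ a″ ⟩
      δ k * (β k * a + α k * a′) + (1# * (d (suc k) * a′) + (γ (suc k) * (β (suc k) * a′ + α (suc k) * a″) + 0#))
        ≈⟨ +-cong (*-congˡ (E-odd n k)) (+-cong (*-congˡ (E-even n (suc k))) (+-congʳ (*-congˡ (E-odd n (suc k))))) ⟨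
      ⟦ right (suc k) ⟧ (E (suc n))                       ∎
      where
      a = A n k
      a′ = A n (suc k)
      a″ = A n (suc (suc k))

    A-from-E : ∀ {n} (rows : Fin n → ℕ) → PositiveMinors rows E → PositiveMinors rows A
    A-from-E rows TP cols inc = P-resp (det-cong λ i j → ≈-sym (A≈ER (rows i) (cols j)))
      (staircase right (λ k m → Near m k) right-positive near-monoʳ rows E TP cols inc)

    E-from-A : ∀ {n} (rows : Fin n → ℕ) → PositiveMinors rows A → PositiveMinors (suc ∘ rows) E
    E-from-A rows TP = staircase left Near left-positive near-monoˡ rows A TP

    E-top-positive : ∀ m → P (E 0 m)
    E-top-positive zero    = P-1
    E-top-positive (suc m) = P-0

    E-top-zero : ∀ {m} → 0 ℕ.< m → E 0 m ≈ 0#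
    E-top-zero {suc m} _ = ≈-refl

    -- Induction on the strict bound N for the row indices.
    E-minors : ∀ N {n} (rows : Fin n → ℕ) → StrictlyIncreasing rows → (∀ i → rows i ℕ.< N) →
               PositiveMinors rows E
    -- The case in which row 0 is not among the rows: it follows from minors of
    -- A whose rows are smaller by one.
    E-minors-below : ∀ N {n} (rows : Fin n → ℕ) → StrictlyIncreasing rows →
                     (∀ i → 0 ℕ.< rows i) → (∀ i → rows i ℕ.< suc N) → PositiveMinors rows E

    E-minors N {zero} rows inc <N cols inc′ = P-1
    E-minors zero {suc n} rows inc <N with () ← <N zero
    E-minors (suc N) {suc n} rows inc <N cols inc′ = byFirstRow (rows zero) refl
      where
      M : SquareMatrix (suc n)
      M i j = E (rows i) (cols j)
      above : ∀ {n} {f : Fin (suc n) → ℕ} → StrictlyIncreasing f → ∀ i → 0 ℕ.< f (suc i)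
      above {f = f} f-inc i = ℕ.≤-<-trans z≤n (f-inc {zero} {suc i} z<s)
      byFirstRow : ∀ m → rows zero ≡ m → P (det M)
      byFirstRow (suc _) eq = E-minors-below N rows inc 0<rows <N cols inc′
        where
        0<rows : ∀ i → 0 ℕ.< rows i
        0<rows zero    = subst (0 ℕ.<_) (≡.sym eq) z<s
        0<rows (suc i) = above inc i
      -- Row 0 of E is zero beyond column 0, so only the first term of the
      -- expansion along it remains.
      byFirstRow zero eq = P-resp (≈-sym (det-firstRow M top)) (P-* corner rest)
        where
        corner : P (M zero zero)
        corner = subst (λ m → P (E m (cols zero))) (≡.sym eq) (E-top-positive (cols zero))
        top : ∀ j → M zero (suc j) ≈ 0#
        top j = ≈-trans (reflexive (cong (λ m → E m (cols (suc j))) eq)) (E-top-zero (above inc′ j))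
        rest : P (det λ i j → M (suc i) (suc j))
        rest = E-minors-below N (rows ∘ suc) (λ i<j → inc (s<s i<j)) (above inc) (<N ∘ suc)
          (cols ∘ suc) (λ i<j → inc′ (s<s i<j))

    E-minors-below N {n} rows inc 0<rows <N cols inc′ =
      P-resp (det-cong λ i j → reflexive (cong (λ m → E m (cols j)) (suc-pred i)))
        (E-from-A (pred ∘ rows) (A-from-E (pred ∘ rows) (E-minors N (pred ∘ rows) pred-inc pred<N)) cols inc′)
      where
      suc-pred : ∀ i → suc (pred (rows i)) ≡ rows i
      suc-pred i = ℕ.suc-pred (rows i) {{ℕ.>-nonZero (0<rows i)}}
      pred-inc : StrictlyIncreasing (pred ∘ rows)
      pred-inc {i} {j} i<j = ℕ.s<s⁻¹ (≡.subst₂ ℕ._<_ (≡.sym (suc-pred i)) (≡.sym (suc-pred j)) (inc i<j))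
      pred<N : ∀ i → pred (rows i) ℕ.< N
      pred<N i = ℕ.s<s⁻¹ (subst (ℕ._< suc N) (≡.sym (suc-pred i)) (<N i))

    A-totallyPositive : ∀ {n} (rows : Fin n → ℕ) → StrictlyIncreasing rows → PositiveMinors rows A
    A-totallyPositive rows inc with N , <N ← strictlyBounded rows =
      A-from-E rows (E-minors N rows inc <N)

  ----------------------------------------------------------------------
  -- The three sufficient conditions

  -- The preorder defined by the cone.
  infix 4 _≽_
  _≽_ : Carrier → Carrier → Set p
  x ≽ y = P (x + - y)

  -- All minors of the infinite matrix X lie in P.
  TotallyPositive : (ℕ → ℕ → Carrier) → Set p
  TotallyPositive X = ∀ n (rows cols : Fin n → ℕ) →
    StrictlyIncreasing rows → StrictlyIncreasing cols → P (det λ i j → X (rows i) (cols j))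

  -- The total positivity criterion over any commutative ring with a cone.
  recMatrix-totallyPositive :
    (r s t : ℕ → Carrier) →
    (∀ k → P (r (suc k))) → (∀ k → P (t (suc k))) →
      ((s 0 ≽ r 1) × (∀ k → k ℕ.≥ 1 → s k ≽ r (suc k) + t k))
    ⊎ ((s 0 ≽ t 1) × (∀ k → k ℕ.≥ 1 → s k ≽ r k + t (suc k)))
    ⊎ ((s 0 ≽ 1#) × (∀ k → k ℕ.≥ 1 → s k ≽ r k * t k + 1#)) →
    TotallyPositive (recMatrix r s t)
  recMatrix-totallyPositive r s t r≥0 t≥0 conditions n rows cols rows< cols< = byCase conditions
    where
    r⁺ t⁺ one : ℕ → Carrier
    r⁺ k  = r (suc k)
    t⁺ k  = t (suc k)
    one _ = 1#

    -- The slack d of an inequality s k ≽ e k; the bound e is the one of the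
    -- condition at hand.
    residual : (ℕ → Carrier) → ℕ → Carrier
    residual e k = s k + - e k

    split : ∀ e {x y} → e ≈ y → x ≈ (x + - e) + y
    split e {x} {y} e≈y = begin
      x                  ≈⟨ +-identityʳ x ⟨
      x + 0#             ≈⟨ +-congˡ (-‿inverseˡ e) ⟨
      x + (- e + e)      ≈⟨ +-assoc x (- e) e ⟨
      (x + - e) + e      ≈⟨ +-congˡ e≈y ⟩
      (x + - e) + y      ∎

    byCase : _ → P (det λ i j → recMatrix r s t (rows i) (cols j))
    byCase (inj₁ (s₀ , s₊)) = Factored.A-totallyPositive
      (residual e) t⁺ r⁺ one one
      (λ { zero → s₀ ; (suc k) → s₊ (suc k) z<s }) t≥0 r≥0 (λ _ → P-1) (λ _ → P-1)
      r s t (λ k → ≈-sym (*-identityʳ _)) (λ k → ≈-sym (*-identityʳ _))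
      (split (e 0) (≈-sym (*-identityʳ _)))
      (λ k → split (e (suc k)) (≈-trans (+-comm _ _) (≈-sym (+-cong (*-identityʳ _) (*-identityʳ _)))))
      rows rows< cols cols<
      where
      e : ℕ → Carrier
      e zero    = r 1
      e (suc k) = r (suc (suc k)) + t (suc k)
    byCase (inj₂ (inj₁ (s₀ , s₊))) = Factored.A-totallyPositive
      (residual e) one one t⁺ r⁺
      (λ { zero → s₀ ; (suc k) → s₊ (suc k) z<s }) (λ _ → P-1) (λ _ → P-1) t≥0 r≥0
      r s t (λ k → ≈-sym (*-identityˡ _)) (λ k → ≈-sym (*-identityˡ _))
      (split (e 0) (≈-sym (*-identityˡ _)))
      (λ k → split (e (suc k)) (≈-sym (+-cong (*-identityˡ _) (*-identityˡ _))))
      rows rows< cols cols<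
      where
      e : ℕ → Carrier
      e zero    = t 1
      e (suc k) = r (suc k) + t (suc (suc k))
    byCase (inj₂ (inj₂ (s₀ , s₊))) = Factored.A-totallyPositive
      (residual e) t⁺ one one r⁺
      (λ { zero → s₀ ; (suc k) → s₊ (suc k) z<s }) t≥0 (λ _ → P-1) (λ _ → P-1) r≥0
      r s t (λ k → ≈-sym (*-identityˡ _)) (λ k → ≈-sym (*-identityʳ _))
      (split (e 0) (≈-sym (*-identityˡ _)))
      (λ k → split (e (suc k)) (+-cong (*-comm _ _) (≈-sym (*-identityˡ _))))
      rows rows< cols cols<
      where
      e : ℕ → Carrier
      e zero    = 1#
      e (suc k) = r (suc k) * t (suc k) + 1#

------------------------------------------------------------------------
-- The reals form a commutative ring

-- A commutative ring from its operations and laws, the second half of each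
-- two-sided law being derived from commutativity.
module _ {c ℓ} (raw : RawRing c ℓ) where
  open RawRing raw

  commutativeRing :
    IsEquivalence _≈_ →
    (∀ {x x′ y y′} → x ≈ x′ → y ≈ y′ → (x + y) ≈ (x′ + y′)) →
    (∀ x y z → ((x + y) + z) ≈ (x + (y + z))) →
    (∀ x y → (x + y) ≈ (y + x)) →
    (∀ x → (0# + x) ≈ x) →
    (∀ {x x′} → x ≈ x′ → (- x) ≈ (- x′)) →
    (∀ x → ((- x) + x) ≈ 0#) →
    (∀ {x x′ y y′} → x ≈ x′ → y ≈ y′ → (x * y) ≈ (x′ * y′)) →
    (∀ x y z → ((x * y) * z) ≈ (x * (y * z))) →
    (∀ x y → (x * y) ≈ (y * x)) →
    (∀ x → (1# * x) ≈ x) →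
    (∀ x y z → ((x + y) * z) ≈ ((x * z) + (y * z))) →
    CommutativeRing c ℓ
  commutativeRing equiv +-cong +-assoc +-comm +-idˡ -‿cong -‿invˡ *-cong *-assoc *-comm *-idˡ distribʳ = record
    { isCommutativeRing = record
      { isRing = record
        { +-isAbelianGroup = record
          { isGroup = record
            { isMonoid = record
              { isSemigroup = record
                { isMagma = record { isEquivalence = equiv ; ∙-cong = +-cong }
                ; assoc = +-assoc }
              ; identity = +-idˡ , λ x → trans (+-comm x 0#) (+-idˡ x) }
            ; inverse = -‿invˡ , λ x → trans (+-comm x (- x)) (-‿invˡ x)
            ; ⁻¹-cong = -‿cong }
          ; comm = +-comm }
        ; *-cong = *-cong
        ; *-assoc = *-assoc
        ; *-identity = *-idˡ , λ x → trans (*-comm x 1#) (*-idˡ x)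
        ; distrib = (λ x y z → trans (*-comm x (y + z)) (trans (distribʳ y z x) (+-cong (*-comm y x) (*-comm z x))))
                  , λ x y z → distribʳ y z x }
      ; *-comm = *-comm } }
    where open IsEquivalence equiv using (trans)

½+½ : ∀ ε → ½ ℚ.* ε ℚ.+ ½ ℚ.* ε ≡ ε
½+½ ε = ≡.trans (≡.sym (ℚ.*-distribʳ-+ ε ½ ½)) (ℚ.*-identityˡ ε)

½-positive : ∀ {ε} → 0ℚ ℚ.< ε → 0ℚ ℚ.< ½ ℚ.* ε
½-positive {ε} 0<ε = subst (ℚ._< ½ ℚ.* ε) (ℚ.*-zeroʳ ½) (ℚ.*-monoʳ-<-pos ½ 0<ε)

p≤∣p∣ : ∀ p → p ℚ.≤ ℚ.∣ p ∣
p≤∣p∣ p with ℚ.≤-total 0ℚ p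
... | inj₁ 0≤p = ℚ.≤-reflexive (≡.sym (ℚ.0≤p⇒∣p∣≡p 0≤p))
... | inj₂ p≤0 = ℚ.≤-trans p≤0 (ℚ.0≤∣p∣ p)

-- Q n holds for all n from some index on.
Eventually : ∀ {q} → (ℕ → Set q) → Set q
Eventually Q = ∃[ N ] (∀ n → N ℕ.≤ n → Q n)

eventually-map : ∀ {p q} {P : ℕ → Set p} {Q : ℕ → Set q} →
                 (∀ n → P n → Q n) → Eventually P → Eventually Q
eventually-map f (N , h) = N , λ n N≤n → f n (h n N≤n)

eventually-zip : ∀ {p q r} {P : ℕ → Set p} {Q : ℕ → Set q} {R : ℕ → Set r} →
                 (∀ n → P n → Q n → R n) → Eventually P → Eventually Q → Eventually R
eventually-zip f (M , g) (N , h) = M ℕ.⊔ N , λ n ≤n →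
  f n (g n (ℕ.m⊔n≤o⇒m≤o M N ≤n)) (h n (ℕ.m⊔n≤o⇒n≤o M N ≤n))

-- Sequences tending to zero.  By definition, x ≈ᴿ y says that the difference
-- of the two representing sequences is null.
Null : (ℕ → ℚ) → Set
Null z = ∀ ε → 0ℚ ℚ.< ε → Eventually λ n → ℚ.∣ z n ∣ ℚ.< ε

-- Bounded from some index on.
Bounded : (ℕ → ℚ) → Set
Bounded b = ∃[ B ] (0ℚ ℚ.< B × Eventually λ n → ℚ.∣ b n ∣ ℚ.≤ B)

null-resp : ∀ {z w} → (∀ n → z n ≡ w n) → Null z → Null w
null-resp z≡w z→0 ε 0<ε = eventually-map (λ n → subst (λ q → ℚ.∣ q ∣ ℚ.< ε) (z≡w n)) (z→0 ε 0<ε)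

null-zero : ∀ {z} → (∀ n → z n ≡ 0ℚ) → Null z
null-zero z≡0 ε 0<ε = 0 , λ n _ → subst (λ q → ℚ.∣ q ∣ ℚ.< ε) (≡.sym (z≡0 n)) 0<ε

null-neg : ∀ {z} → Null z → Null (λ n → ℚ.- z n)
null-neg z→0 ε 0<ε = eventually-map (λ n → subst (ℚ._< ε) (≡.sym (ℚ.∣-p∣≡∣p∣ _))) (z→0 ε 0<ε)

null-+ : ∀ {z w} → Null z → Null w → Null (λ n → z n ℚ.+ w n)
null-+ {z} {w} z→0 w→0 ε 0<ε = eventually-zip
  (λ n z< w< → ℚ.≤-<-trans (ℚ.∣p+q∣≤∣p∣+∣q∣ (z n) (w n))
    (subst (ℚ.∣ z n ∣ ℚ.+ ℚ.∣ w n ∣ ℚ.<_) (½+½ ε) (ℚ.+-mono-< z< w<)))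
  (z→0 (½ ℚ.* ε) (½-positive 0<ε)) (w→0 (½ ℚ.* ε) (½-positive 0<ε))

null-* : ∀ {b z} → Bounded b → Null z → Null (λ n → b n ℚ.* z n)
null-* {b} {z} (B , 0<B , b≤B) z→0 ε 0<ε =
  eventually-zip small b≤B (z→0 (ℚ.1/ B ℚ.* ε) 0<ε/B)
  where
  open ℚ.≤-Reasoning
  instance
    B-pos : ℚ.Positive B
    B-pos = ℚ.positive 0<B
    B≢0 : ℚ.NonZero B
    B≢0 = ℚ.pos⇒nonZero B
    1/B-pos : ℚ.Positive (ℚ.1/ B)
    1/B-pos = ℚ.1/pos⇒pos B
  0<ε/B : 0ℚ ℚ.< ℚ.1/ B ℚ.* ε
  0<ε/B = subst (ℚ._< ℚ.1/ B ℚ.* ε) (ℚ.*-zeroʳ (ℚ.1/ B)) (ℚ.*-monoʳ-<-pos (ℚ.1/ B) 0<ε)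
  small : ∀ n → ℚ.∣ b n ∣ ℚ.≤ B → ℚ.∣ z n ∣ ℚ.< ℚ.1/ B ℚ.* ε → ℚ.∣ b n ℚ.* z n ∣ ℚ.< ε
  small n b≤ z< = begin-strict
    ℚ.∣ b n ℚ.* z n ∣          ≡⟨ ℚ.∣p*q∣≡∣p∣*∣q∣ (b n) (z n) ⟩
    ℚ.∣ b n ∣ ℚ.* ℚ.∣ z n ∣    ≤⟨ ℚ.*-monoʳ-≤-nonNeg ℚ.∣ z n ∣ {{ℚ.∣-∣-nonNeg (z n)}} b≤ ⟩
    B ℚ.* ℚ.∣ z n ∣            <⟨ ℚ.*-monoʳ-<-pos B z< ⟩
    B ℚ.* (ℚ.1/ B ℚ.* ε)       ≡⟨ ℚ.*-assoc B (ℚ.1/ B) ε ⟨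
    (B ℚ.* ℚ.1/ B) ℚ.* ε       ≡⟨ cong (ℚ._* ε) (ℚ.*-inverseʳ B) ⟩
    1ℚ ℚ.* ε                   ≡⟨ ℚ.*-identityˡ ε ⟩
    ε                          ∎

cauchy⇒bounded : ∀ x → IsCauchy x → Bounded x
cauchy⇒bounded x xc with N , close ← xc 1ℚ (ℚ.positive⁻¹ 1ℚ) =
  1ℚ ℚ.+ ℚ.∣ x N ∣ , ℚ.+-mono-<-≤ (ℚ.positive⁻¹ 1ℚ) (ℚ.0≤∣p∣ (x N)) , N , λ n N≤n → begin
    ℚ.∣ x n ∣                         ≡⟨ cong ℚ.∣_∣ (split (x n) (x N)) ⟩
    ℚ.∣ (x n ℚ.- x N) ℚ.+ x N ∣       ≤⟨ ℚ.∣p+q∣≤∣p∣+∣q∣ (x n ℚ.- x N) (x N) ⟩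
    ℚ.∣ x n ℚ.- x N ∣ ℚ.+ ℚ.∣ x N ∣   ≤⟨ ℚ.+-monoˡ-≤ ℚ.∣ x N ∣ (ℚ.<⇒≤ (close n N N≤n ℕ.≤-refl)) ⟩
    1ℚ ℚ.+ ℚ.∣ x N ∣                  ∎
  where
  open ℚ.≤-Reasoning
  split : ∀ a b → a ≡ (a ℚ.- b) ℚ.+ b
  split = solve 2 (λ a b → a := (a :- b) :+ b) refl
    where open +-*-Solver

bounded : (x : ℝ) → Bounded (seq x)
bounded x = cauchy⇒bounded (seq x) (cauchy x)

pointwise⇒≈ᴿ : (x y : ℝ) → (∀ n → seq x n ≡ seq y n) → x ≈ᴿ y
pointwise⇒≈ᴿ x y eq = null-zero {λ n → seq x n ℚ.- seq y n} λ n →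
  ≡.trans (cong (λ q → q ℚ.- seq y n) (eq n)) (ℚ.+-inverseʳ (seq y n))

-- The reals are explicit arguments of the congruence lemmas: x ≈ᴿ y unfolds to
-- a statement about sequences, from which x and y cannot be inferred.
module ℝ-Ring where
  open RawRing ℝ-rawRing public using (_+_; _*_; -_; 0#; 1#)

  ≈-isEquivalence : IsEquivalence _≈ᴿ_
  ≈-isEquivalence = record
    { refl  = λ {x} → pointwise⇒≈ᴿ x x (λ _ → refl)
    ; sym   = λ {x} {y} x≈y → null-resp (λ n → flip (seq x n) (seq y n)) (null-neg x≈y)
    ; trans = λ {x} {y} {z} x≈y y≈z →
        null-resp (λ n → telescope (seq x n) (seq y n) (seq z n)) (null-+ x≈y y≈z)
    }
    where
    open +-*-Solver
    flip : ∀ a b → ℚ.- (a ℚ.- b) ≡ b ℚ.- a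
    flip = solve 2 (λ a b → :- (a :- b) := b :- a) refl
    telescope : ∀ a b c → (a ℚ.- b) ℚ.+ (b ℚ.- c) ≡ a ℚ.- c
    telescope = solve 3 (λ a b c → (a :- b) :+ (b :- c) := a :- c) refl

  +-cong : ∀ x x′ y y′ → x ≈ᴿ x′ → y ≈ᴿ y′ → (x + y) ≈ᴿ (x′ + y′)
  +-cong x x′ y y′ x≈ y≈ =
    null-resp (λ n → rearrange (seq x n) (seq x′ n) (seq y n) (seq y′ n)) (null-+ x≈ y≈)
    where
    open +-*-Solver
    rearrange : ∀ a a′ b b′ → (a ℚ.- a′) ℚ.+ (b ℚ.- b′) ≡ (a ℚ.+ b) ℚ.- (a′ ℚ.+ b′)
    rearrange = solve 4 (λ a a′ b b′ → (a :- a′) :+ (b :- b′) := (a :+ b) :- (a′ :+ b′)) refl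

  -‿cong : ∀ x x′ → x ≈ᴿ x′ → (- x) ≈ᴿ (- x′)
  -‿cong x x′ x≈ = null-resp (λ n → rearrange (seq x n) (seq x′ n)) (null-neg x≈)
    where
    open +-*-Solver
    rearrange : ∀ a b → ℚ.- (a ℚ.- b) ≡ (ℚ.- a) ℚ.- (ℚ.- b)
    rearrange = solve 2 (λ a b → :- (a :- b) := (:- a) :- (:- b)) refl

  *-cong : ∀ x x′ y y′ → x ≈ᴿ x′ → y ≈ᴿ y′ → (x * y) ≈ᴿ (x′ * y′)
  *-cong x x′ y y′ x≈ y≈ =
    null-resp (λ n → rearrange (seq x n) (seq x′ n) (seq y n) (seq y′ n))
      (null-+ (null-* (bounded x) y≈) (null-* (bounded y′) x≈))
    where
    open +-*-Solver
    rearrange : ∀ a a′ b b′ → a ℚ.* (b ℚ.- b′) ℚ.+ b′ ℚ.* (a ℚ.- a′) ≡ a ℚ.* b ℚ.- a′ ℚ.* b′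
    rearrange = solve 4 (λ a a′ b b′ → a :* (b :- b′) :+ b′ :* (a :- a′) := a :* b :- a′ :* b′) refl

ℝ-commutativeRing : CommutativeRing _ _
ℝ-commutativeRing = commutativeRing ℝ-rawRing ℝ-Ring.≈-isEquivalence
  (λ {x} {x′} {y} {y′} → ℝ-Ring.+-cong x x′ y y′)
  (λ x y z → pointwise⇒≈ᴿ ((x + y) + z) (x + (y + z)) λ n → ℚ.+-assoc (seq x n) (seq y n) (seq z n))
  (λ x y → pointwise⇒≈ᴿ (x + y) (y + x) λ n → ℚ.+-comm (seq x n) (seq y n))
  (λ x → pointwise⇒≈ᴿ (0# + x) x λ n → ℚ.+-identityˡ (seq x n))
  (λ {x} {x′} → ℝ-Ring.-‿cong x x′)
  (λ x → pointwise⇒≈ᴿ ((- x) + x) 0# λ n → ℚ.+-inverseˡ (seq x n))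
  (λ {x} {x′} {y} {y′} → ℝ-Ring.*-cong x x′ y y′)
  (λ x y z → pointwise⇒≈ᴿ ((x * y) * z) (x * (y * z)) λ n → ℚ.*-assoc (seq x n) (seq y n) (seq z n))
  (λ x y → pointwise⇒≈ᴿ (x * y) (y * x) λ n → ℚ.*-comm (seq x n) (seq y n))
  (λ x → pointwise⇒≈ᴿ (1# * x) x λ n → ℚ.*-identityˡ (seq x n))
  (λ x y z → pointwise⇒≈ᴿ ((x + y) * z) ((x * z) + (y * z)) λ n →
    ℚ.*-distribʳ-+ (seq z n) (seq x n) (seq y n))
  where open ℝ-Ring

------------------------------------------------------------------------
-- The nonnegative reals form a cone

-- The sequence x - |x|.  A real is nonnegative iff it is null, so products
-- of nonnegative reals can be estimated like products of null sequences and
-- bounded ones.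
abs-defect : (ℕ → ℚ) → ℕ → ℚ
abs-defect x n = x n ℚ.- ℚ.∣ x n ∣

-- If p ≥ -δ, then |p - |p|| is at most 2δ; here δ = ε/4.
nonNeg⇒null : ∀ x → 0ᴿ ≤ᴿ x → Null (abs-defect (seq x))
nonNeg⇒null x 0≤x ε 0<ε = eventually-map (λ n → small (seq x n)) (0≤x (½ ℚ.* (½ ℚ.* ε)) (½-positive 0<½ε))
  where
  open ℚ.≤-Reasoning
  0<½ε = ½-positive 0<ε
  ½ε<ε : ½ ℚ.* ε ℚ.< ε
  ½ε<ε = subst (½ ℚ.* ε ℚ.<_) (½+½ ε)
    (subst (ℚ._< ½ ℚ.* ε ℚ.+ ½ ℚ.* ε) (ℚ.+-identityʳ _) (ℚ.+-monoʳ-< (½ ℚ.* ε) 0<½ε))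
  small : ∀ p → 0ℚ ℚ.≤ p ℚ.+ ½ ℚ.* (½ ℚ.* ε) → ℚ.∣ p ℚ.- ℚ.∣ p ∣ ∣ ℚ.< ε
  small p 0≤p+δ with ℚ.∣p∣≡p∨∣p∣≡-p p
  ... | inj₁ ∣p∣≡p = subst (λ q → ℚ.∣ q ∣ ℚ.< ε)
    (≡.sym (≡.trans (cong (λ q → p ℚ.- q) ∣p∣≡p) (ℚ.+-inverseʳ p))) 0<ε
  ... | inj₂ ∣p∣≡-p = begin-strict
    ℚ.∣ p ℚ.- ℚ.∣ p ∣ ∣                ≤⟨ ℚ.∣p-q∣≤∣p∣+∣q∣ p ℚ.∣ p ∣ ⟩
    ℚ.∣ p ∣ ℚ.+ ℚ.∣ ℚ.∣ p ∣ ∣          ≡⟨ cong (ℚ.∣ p ∣ ℚ.+_) (ℚ.∣∣p∣∣≡∣p∣ p) ⟩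
    ℚ.∣ p ∣ ℚ.+ ℚ.∣ p ∣                ≤⟨ ℚ.+-mono-≤ ∣p∣≤δ ∣p∣≤δ ⟩
    δ ℚ.+ δ                            ≡⟨ ½+½ (½ ℚ.* ε) ⟩
    ½ ℚ.* ε                            <⟨ ½ε<ε ⟩
    ε                                  ∎
    where
    δ = ½ ℚ.* (½ ℚ.* ε)
    cancel : ∀ p d → (p ℚ.+ d) ℚ.- p ≡ d
    cancel = solve 2 (λ p d → (p :+ d) :- p := d) refl
      where open +-*-Solver
    ∣p∣≤δ : ℚ.∣ p ∣ ℚ.≤ δ
    ∣p∣≤δ = begin
      ℚ.∣ p ∣             ≡⟨ ∣p∣≡-p ⟩
      ℚ.- p               ≡⟨ ℚ.+-identityˡ (ℚ.- p) ⟨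
      0ℚ ℚ.- p            ≤⟨ ℚ.+-monoˡ-≤ (ℚ.- p) 0≤p+δ ⟩
      (p ℚ.+ δ) ℚ.- p     ≡⟨ cancel p δ ⟩
      δ                   ∎

null⇒nonNeg : ∀ x → Null (abs-defect (seq x)) → 0ᴿ ≤ᴿ x
null⇒nonNeg x x→0 ε 0<ε = eventually-map (λ n → large (seq x n)) (x→0 ε 0<ε)
  where
  open ℚ.≤-Reasoning
  split : ∀ a b → b ≡ a ℚ.- (a ℚ.- b)
  split = solve 2 (λ a b → b := a :- (a :- b)) refl
    where open +-*-Solver
  -p≤∣p∣ : ∀ p → ℚ.- p ℚ.≤ ℚ.∣ p ∣
  -p≤∣p∣ p = ℚ.≤-trans (p≤∣p∣ (ℚ.- p)) (ℚ.≤-reflexive (ℚ.∣-p∣≡∣p∣ p))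
  large : ∀ p → ℚ.∣ p ℚ.- ℚ.∣ p ∣ ∣ ℚ.< ε → 0ℚ ℚ.≤ p ℚ.+ ε
  large p <ε = begin
    0ℚ                             ≤⟨ ℚ.0≤∣p∣ p ⟩
    ℚ.∣ p ∣                        ≡⟨ split p ℚ.∣ p ∣ ⟩
    p ℚ.- (p ℚ.- ℚ.∣ p ∣)          ≤⟨ ℚ.+-monoʳ-≤ p (ℚ.≤-trans (-p≤∣p∣ _) (ℚ.<⇒≤ <ε)) ⟩
    p ℚ.+ ε                        ∎

ℝ-nonNeg : IsPositiveCone ℝ-commutativeRing (0ᴿ ≤ᴿ_)
ℝ-nonNeg = record
  { P-resp = λ {x} {y} → resp x y
  ; P-0    = λ ε 0<ε → 0 , λ n _ → ℚ.≤-trans (ℚ.<⇒≤ 0<ε) (ℚ.≤-reflexive (≡.sym (ℚ.+-identityˡ ε)))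
  ; P-1    = λ ε 0<ε → 0 , λ n _ → ℚ.+-mono-≤ (ℚ.<⇒≤ (ℚ.positive⁻¹ 1ℚ)) (ℚ.<⇒≤ 0<ε)
  ; P-+    = λ {x} {y} → sum x y
  ; P-*    = λ {x} {y} → product x y
  }
  where
  open ℝ-Ring
  open ℚ.≤-Reasoning
  sum : ∀ x y → 0ᴿ ≤ᴿ x → 0ᴿ ≤ᴿ y → 0ᴿ ≤ᴿ (x + y)
  sum x y 0≤x 0≤y ε 0<ε = eventually-zip (λ n → add (seq x n) (seq y n))
    (0≤x (½ ℚ.* ε) (½-positive 0<ε)) (0≤y (½ ℚ.* ε) (½-positive 0<ε))
    where
    open +-*-Solver
    rearrange : ∀ p q d → (p ℚ.+ d) ℚ.+ (q ℚ.+ d) ≡ (p ℚ.+ q) ℚ.+ (d ℚ.+ d)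
    rearrange = solve 3 (λ p q d → (p :+ d) :+ (q :+ d) := (p :+ q) :+ (d :+ d)) refl
    add : ∀ p q → 0ℚ ℚ.≤ p ℚ.+ ½ ℚ.* ε → 0ℚ ℚ.≤ q ℚ.+ ½ ℚ.* ε → 0ℚ ℚ.≤ (p ℚ.+ q) ℚ.+ ε
    add p q 0≤p 0≤q = begin
      0ℚ                                       ≤⟨ ℚ.+-mono-≤ 0≤p 0≤q ⟩
      (p ℚ.+ ½ ℚ.* ε) ℚ.+ (q ℚ.+ ½ ℚ.* ε)      ≡⟨ rearrange p q (½ ℚ.* ε) ⟩
      (p ℚ.+ q) ℚ.+ (½ ℚ.* ε ℚ.+ ½ ℚ.* ε)      ≡⟨ cong ((p ℚ.+ q) ℚ.+_) (½+½ ε) ⟩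
      (p ℚ.+ q) ℚ.+ ε                          ∎
  resp : ∀ x y → x ≈ᴿ y → 0ᴿ ≤ᴿ x → 0ᴿ ≤ᴿ y
  resp x y x≈y 0≤x ε 0<ε = eventually-zip (λ n → move (seq x n) (seq y n))
    (x≈y (½ ℚ.* ε) (½-positive 0<ε)) (0≤x (½ ℚ.* ε) (½-positive 0<ε))
    where
    rearrange : ∀ p q d → p ℚ.+ d ≡ q ℚ.+ ((p ℚ.- q) ℚ.+ d)
    rearrange = solve 3 (λ p q d → p :+ d := q :+ ((p :- q) :+ d)) refl
      where open +-*-Solver
    move : ∀ p q → ℚ.∣ p ℚ.- q ∣ ℚ.< ½ ℚ.* ε → 0ℚ ℚ.≤ p ℚ.+ ½ ℚ.* ε → 0ℚ ℚ.≤ q ℚ.+ ε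
    move p q close 0≤p = begin
      0ℚ                                       ≤⟨ 0≤p ⟩
      p ℚ.+ ½ ℚ.* ε                            ≡⟨ rearrange p q (½ ℚ.* ε) ⟩
      q ℚ.+ ((p ℚ.- q) ℚ.+ ½ ℚ.* ε)            ≤⟨ ℚ.+-monoʳ-≤ q (ℚ.+-monoˡ-≤ (½ ℚ.* ε) (ℚ.≤-trans (p≤∣p∣ (p ℚ.- q)) (ℚ.<⇒≤ close))) ⟩
      q ℚ.+ (½ ℚ.* ε ℚ.+ ½ ℚ.* ε)              ≡⟨ cong (q ℚ.+_) (½+½ ε) ⟩
      q ℚ.+ ε                                  ∎
  abs-bounded : ∀ {b} → Bounded b → Bounded (λ n → ℚ.∣ b n ∣)
  abs-bounded {b} (B , 0<B , b≤B) =
    B , 0<B , eventually-map (λ n → subst (ℚ._≤ B) (≡.sym (ℚ.∣∣p∣∣≡∣p∣ (b n)))) b≤B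
  -- xy - |xy| = x (y - |y|) + |y| (x - |x|)
  product : ∀ x y → 0ᴿ ≤ᴿ x → 0ᴿ ≤ᴿ y → 0ᴿ ≤ᴿ (x * y)
  product x y 0≤x 0≤y = null⇒nonNeg (x * y)
    (null-resp (λ n → ≡.trans (rearrange (seq x n) ℚ.∣ seq x n ∣ (seq y n) ℚ.∣ seq y n ∣)
                              (cong (λ p → seq x n ℚ.* seq y n ℚ.- p) (≡.sym (ℚ.∣p*q∣≡∣p∣*∣q∣ (seq x n) (seq y n)))))
      (null-+ (null-* (bounded x) (nonNeg⇒null y 0≤y))
              (null-* (abs-bounded (bounded y)) (nonNeg⇒null x 0≤x))))
    where
    open +-*-Solver
    rearrange : ∀ a a′ b b′ → a ℚ.* (b ℚ.- b′) ℚ.+ b′ ℚ.* (a ℚ.- a′) ≡ a ℚ.* b ℚ.- a′ ℚ.* b′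
    rearrange = solve 4 (λ a a′ b b′ → a :* (b :- b′) :+ b′ :* (a :- a′) := a :* b :- a′ :* b′) refl

------------------------------------------------------------------------
-- Polynomials over a commutative ring, and the cone of those with
-- coefficients in a cone

module PolynomialRing {c ℓ} (R : CommutativeRing c ℓ) where
  open CommutativeRing R hiding (zero) renaming (refl to ≈-refl)
  open Polynomial rawRing
  open RingProperties ring using (-0#≈0#)
  open NaturalSolver commutativeSemiring using (solve; _:=_; _:+_; _:*_; con)
  open import Relation.Binary.Reasoning.Setoid setoid

  infix 4 _≋_
  _≋_ : Poly → Poly → Set ℓ
  f ≋ g = ∀ i → coeff f i ≈ coeff g i

  ≋-isEquivalence : IsEquivalence _≋_
  ≋-isEquivalence = record
    { refl  = λ i → ≈-refl
    ; sym   = λ f≋g i → sym (f≋g i)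
    ; trans = λ f≋g g≋h i → trans (f≋g i) (g≋h i)
    }

  coeff-+ : ∀ f g i → coeff (addP f g) i ≈ coeff f i + coeff g i
  coeff-+ []      g       i       = sym (+-identityˡ _)
  coeff-+ (a ∷ f) []      i       = sym (+-identityʳ _)
  coeff-+ (a ∷ f) (b ∷ g) zero    = ≈-refl
  coeff-+ (a ∷ f) (b ∷ g) (suc i) = coeff-+ f g i

  coeff-scale : ∀ a f i → coeff (map (a *_) f) i ≈ a * coeff f i
  coeff-scale a []      i       = sym (zeroʳ a)
  coeff-scale a (b ∷ f) zero    = ≈-refl
  coeff-scale a (b ∷ f) (suc i) = coeff-scale a f i

  coeff-neg : ∀ f i → coeff (map (-_) f) i ≈ - coeff f i
  coeff-neg []      i       = sym -0#≈0#
  coeff-neg (a ∷ f) zero    = ≈-refl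
  coeff-neg (a ∷ f) (suc i) = coeff-neg f i

  -- (a + q f) g = a g + q (f g)
  coeff-*ˡ : ∀ a f g i → coeff (mulP (a ∷ f) g) i ≈ a * coeff g i + coeff (0# ∷ mulP f g) i
  coeff-*ˡ a f g i = trans (coeff-+ (map (a *_) g) (0# ∷ mulP f g) i) (+-congʳ (coeff-scale a g i))

  -- The polynomial 0# ∷ f is q f.
  shift-cong : ∀ {f g} → f ≋ g → (0# ∷ f) ≋ (0# ∷ g)
  shift-cong f≋g zero    = ≈-refl
  shift-cong f≋g (suc i) = f≋g i

  shift-0 : ∀ {f} → f ≋ [] → (0# ∷ f) ≋ []
  shift-0 f≋0 zero    = ≈-refl
  shift-0 f≋0 (suc i) = f≋0 i

  shift-+ : ∀ f g i → coeff (0# ∷ addP f g) i ≈ coeff (0# ∷ f) i + coeff (0# ∷ g) i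
  shift-+ f g zero    = sym (+-identityˡ 0#)
  shift-+ f g (suc i) = coeff-+ f g i

  shift-scale : ∀ a f i → coeff (0# ∷ map (a *_) f) i ≈ a * coeff (0# ∷ f) i
  shift-scale a f zero    = sym (zeroʳ a)
  shift-scale a f (suc i) = coeff-scale a f i

  addP-cong : ∀ f f′ g g′ → f ≋ f′ → g ≋ g′ → addP f g ≋ addP f′ g′
  addP-cong f f′ g g′ f≋ g≋ i = begin
    coeff (addP f g) i         ≈⟨ coeff-+ f g i ⟩
    coeff f i + coeff g i      ≈⟨ +-cong (f≋ i) (g≋ i) ⟩
    coeff f′ i + coeff g′ i    ≈⟨ coeff-+ f′ g′ i ⟨
    coeff (addP f′ g′) i       ∎

  addP-assoc : ∀ f g h → addP (addP f g) h ≋ addP f (addP g h)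
  addP-assoc f g h i = begin
    coeff (addP (addP f g) h) i              ≈⟨ coeff-+ (addP f g) h i ⟩
    coeff (addP f g) i + coeff h i           ≈⟨ +-congʳ (coeff-+ f g i) ⟩
    (coeff f i + coeff g i) + coeff h i      ≈⟨ +-assoc _ _ _ ⟩
    coeff f i + (coeff g i + coeff h i)      ≈⟨ +-congˡ (coeff-+ g h i) ⟨
    coeff f i + coeff (addP g h) i           ≈⟨ coeff-+ f (addP g h) i ⟨
    coeff (addP f (addP g h)) i              ∎

  addP-comm : ∀ f g → addP f g ≋ addP g f
  addP-comm f g i = begin
    coeff (addP f g) i       ≈⟨ coeff-+ f g i ⟩
    coeff f i + coeff g i    ≈⟨ +-comm _ _ ⟩
    coeff g i + coeff f i    ≈⟨ coeff-+ g f i ⟨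
    coeff (addP g f) i       ∎

  negP-cong : ∀ f f′ → f ≋ f′ → map (-_) f ≋ map (-_) f′
  negP-cong f f′ f≋ i = trans (coeff-neg f i) (trans (-‿cong (f≋ i)) (sym (coeff-neg f′ i)))

  negP-inverseˡ : ∀ f → addP (map (-_) f) f ≋ []
  negP-inverseˡ f i = begin
    coeff (addP (map (-_) f) f) i         ≈⟨ coeff-+ (map (-_) f) f i ⟩
    coeff (map (-_) f) i + coeff f i      ≈⟨ +-congʳ (coeff-neg f i) ⟩
    - coeff f i + coeff f i               ≈⟨ -‿inverseˡ _ ⟩
    0#                                    ∎

  mulP-distribʳ : ∀ f g h → mulP (addP f g) h ≋ addP (mulP f h) (mulP g h)
  mulP-distribʳ []      g       h i = ≈-refl
  mulP-distribʳ (a ∷ f) []      h i = sym (trans (coeff-+ (mulP (a ∷ f) h) [] i) (+-identityʳ _))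
  mulP-distribʳ (a ∷ f) (b ∷ g) h i = begin
    coeff (mulP ((a + b) ∷ addP f g) h) i
      ≈⟨ coeff-*ˡ (a + b) (addP f g) h i ⟩
    (a + b) * hᵢ + coeff (0# ∷ mulP (addP f g) h) i
      ≈⟨ +-congˡ (trans (shift-cong (mulP-distribʳ f g h) i) (shift-+ (mulP f h) (mulP g h) i)) ⟩
    (a + b) * hᵢ + (x + y)
      ≈⟨ solve 5 (λ a b h x y → (a :+ b) :* h :+ (x :+ y) := (a :* h :+ x) :+ (b :* h :+ y)) ≈-refl a b hᵢ x y ⟩
    (a * hᵢ + x) + (b * hᵢ + y)
      ≈⟨ +-cong (coeff-*ˡ a f h i) (coeff-*ˡ b g h i) ⟨
    coeff (mulP (a ∷ f) h) i + coeff (mulP (b ∷ g) h) i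
      ≈⟨ coeff-+ (mulP (a ∷ f) h) (mulP (b ∷ g) h) i ⟨
    coeff (addP (mulP (a ∷ f) h) (mulP (b ∷ g) h)) i ∎
    where
    hᵢ = coeff h i
    x = coeff (0# ∷ mulP f h) i
    y = coeff (0# ∷ mulP g h) i

  mulP-zeroʳ : ∀ f → mulP f [] ≋ []
  mulP-zeroʳ []      i = ≈-refl
  mulP-zeroʳ (a ∷ f) i = shift-0 (mulP-zeroʳ f) i

  -- f (b + q g) = b f + q (f g)
  coeff-*ʳ : ∀ f b g i → coeff (mulP f (b ∷ g)) i ≈ b * coeff f i + coeff (0# ∷ mulP f g) i
  coeff-*ʳ []      b g i = sym (trans (+-cong (zeroʳ b) (shift-0 (λ _ → ≈-refl) i)) (+-identityˡ 0#))
  coeff-*ʳ (a ∷ f) b g zero    = +-congʳ (*-comm a b)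
  coeff-*ʳ (a ∷ f) b g (suc i) = begin
    coeff (mulP (a ∷ f) (b ∷ g)) (suc i)                   ≈⟨ coeff-*ˡ a f (b ∷ g) (suc i) ⟩
    a * coeff g i + coeff (mulP f (b ∷ g)) i               ≈⟨ +-congˡ (coeff-*ʳ f b g i) ⟩
    a * coeff g i + (b * coeff f i + coeff (0# ∷ mulP f g) i)
      ≈⟨ solve 3 (λ x y z → x :+ (y :+ z) := y :+ (x :+ z)) ≈-refl (a * coeff g i) (b * coeff f i) (coeff (0# ∷ mulP f g) i) ⟩
    b * coeff f i + (a * coeff g i + coeff (0# ∷ mulP f g) i)
      ≈⟨ +-congˡ (coeff-*ˡ a f g i) ⟨
    b * coeff f i + coeff (mulP (a ∷ f) g) i               ∎

  mulP-comm : ∀ f g → mulP f g ≋ mulP g f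
  mulP-comm []      g i = sym (mulP-zeroʳ g i)
  mulP-comm (a ∷ f) g i = begin
    coeff (mulP (a ∷ f) g) i                      ≈⟨ coeff-*ˡ a f g i ⟩
    a * coeff g i + coeff (0# ∷ mulP f g) i       ≈⟨ +-congˡ (shift-cong (mulP-comm f g) i) ⟩
    a * coeff g i + coeff (0# ∷ mulP g f) i       ≈⟨ coeff-*ʳ g a f i ⟨
    coeff (mulP g (a ∷ f)) i                      ∎

  mulP-congˡ : ∀ f g g′ → g ≋ g′ → mulP f g ≋ mulP f g′
  mulP-congˡ []      g g′ g≋ i = ≈-refl
  mulP-congˡ (a ∷ f) g g′ g≋ i = begin
    coeff (mulP (a ∷ f) g) i                      ≈⟨ coeff-*ˡ a f g i ⟩
    a * coeff g i + coeff (0# ∷ mulP f g) i       ≈⟨ +-cong (*-congˡ (g≋ i)) (shift-cong (mulP-congˡ f g g′ g≋) i) ⟩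
    a * coeff g′ i + coeff (0# ∷ mulP f g′) i     ≈⟨ coeff-*ˡ a f g′ i ⟨
    coeff (mulP (a ∷ f) g′) i                     ∎

  mulP-cong : ∀ f f′ g g′ → f ≋ f′ → g ≋ g′ → mulP f g ≋ mulP f′ g′
  mulP-cong f f′ g g′ f≋ g≋ i = begin
    coeff (mulP f g) i      ≈⟨ mulP-congˡ f g g′ g≋ i ⟩
    coeff (mulP f g′) i     ≈⟨ mulP-comm f g′ i ⟩
    coeff (mulP g′ f) i     ≈⟨ mulP-congˡ g′ f f′ f≋ i ⟩
    coeff (mulP g′ f′) i    ≈⟨ mulP-comm g′ f′ i ⟩
    coeff (mulP f′ g′) i    ∎

  mulP-scaleˡ : ∀ a f g → mulP (map (a *_) f) g ≋ map (a *_) (mulP f g)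
  mulP-scaleˡ a []      g i = ≈-refl
  mulP-scaleˡ a (b ∷ f) g i = begin
    coeff (mulP (a * b ∷ map (a *_) f) g) i
      ≈⟨ coeff-*ˡ (a * b) (map (a *_) f) g i ⟩
    (a * b) * coeff g i + coeff (0# ∷ mulP (map (a *_) f) g) i
      ≈⟨ +-cong (*-assoc a b _) (trans (shift-cong (mulP-scaleˡ a f g) i) (shift-scale a (mulP f g) i)) ⟩
    a * (b * coeff g i) + a * coeff (0# ∷ mulP f g) i
      ≈⟨ distribˡ a _ _ ⟨
    a * (b * coeff g i + coeff (0# ∷ mulP f g) i)
      ≈⟨ *-congˡ (coeff-*ˡ b f g i) ⟨
    a * coeff (mulP (b ∷ f) g) i
      ≈⟨ coeff-scale a (mulP (b ∷ f) g) i ⟨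
    coeff (map (a *_) (mulP (b ∷ f) g)) i ∎

  mulP-shiftˡ : ∀ f g → mulP (0# ∷ f) g ≋ (0# ∷ mulP f g)
  mulP-shiftˡ f g i = trans (coeff-*ˡ 0# f g i) (trans (+-congʳ (zeroˡ _)) (+-identityˡ _))

  mulP-assoc : ∀ f g h → mulP (mulP f g) h ≋ mulP f (mulP g h)
  mulP-assoc []      g h i = ≈-refl
  mulP-assoc (a ∷ f) g h i = begin
    coeff (mulP (addP (map (a *_) g) (0# ∷ mulP f g)) h) i
      ≈⟨ mulP-distribʳ (map (a *_) g) (0# ∷ mulP f g) h i ⟩
    coeff (addP (mulP (map (a *_) g) h) (mulP (0# ∷ mulP f g) h)) i
      ≈⟨ addP-cong (mulP (map (a *_) g) h) (map (a *_) (mulP g h))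
                   (mulP (0# ∷ mulP f g) h) (0# ∷ mulP f (mulP g h))
                   (mulP-scaleˡ a g h)
                   (λ i → trans (mulP-shiftˡ (mulP f g) h i) (shift-cong (mulP-assoc f g h) i)) i ⟩
    coeff (mulP (a ∷ f) (mulP g h)) i ∎

  mulP-identityˡ : ∀ f → mulP (1# ∷ []) f ≋ f
  mulP-identityˡ f i = trans (coeff-*ˡ 1# [] f i)
    (trans (+-cong (*-identityˡ _) (shift-0 (λ _ → ≈-refl) i)) (+-identityʳ _))

  polynomialRing : CommutativeRing c ℓ
  polynomialRing = commutativeRing polyRawRing ≋-isEquivalence
    (λ {f} {f′} {g} {g′} → addP-cong f f′ g g′)
    addP-assoc addP-comm (λ f i → ≈-refl)
    (λ {f} {f′} → negP-cong f f′) negP-inverseˡ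
    (λ {f} {f′} {g} {g′} → mulP-cong f f′ g g′)
    mulP-assoc mulP-comm mulP-identityˡ mulP-distribʳ

  module _ {p} {P : Carrier → Set p} (cone : IsPositiveCone R P) where
    open IsPositiveCone cone

    PositiveCoeffs : Poly → Set p
    PositiveCoeffs f = ∀ i → P (coeff f i)

    mulP-positive : ∀ f g → PositiveCoeffs f → PositiveCoeffs g → PositiveCoeffs (mulP f g)
    mulP-positive []      g f≥0 g≥0 i = P-0
    mulP-positive (a ∷ f) g f≥0 g≥0 i =
      P-resp (sym (coeff-*ˡ a f g i)) (P-+ (P-* (f≥0 0) (g≥0 i)) (shifted i))
      where
      shifted : PositiveCoeffs (0# ∷ mulP f g)
      shifted zero    = P-0
      shifted (suc i) = mulP-positive f g (λ i → f≥0 (suc i)) g≥0 i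

    positiveCoeffs-isCone : IsPositiveCone polynomialRing PositiveCoeffs
    positiveCoeffs-isCone = record
      { P-resp = λ f≋g f≥0 i → P-resp (f≋g i) (f≥0 i)
      ; P-0    = λ i → P-0
      ; P-1    = λ { zero → P-1 ; (suc i) → P-0 }
      ; P-+    = λ {f} {g} f≥0 g≥0 i → P-resp (sym (coeff-+ f g i)) (P-+ (f≥0 i) (g≥0 i))
      ; P-*    = λ {f} {g} → mulP-positive f g
      }

------------------------------------------------------------------------
-- Real polynomials

open Defs using (recMatrix; Poly)

ℝ[q] : CommutativeRing _ _
ℝ[q] = PolynomialRing.polynomialRing ℝ-commutativeRing

ℝ[q]-nonNeg : IsPositiveCone ℝ[q] NonNegCoeffs
ℝ[q]-nonNeg = PolynomialRing.positiveCoeffs-isCone ℝ-commutativeRing ℝ-nonNeg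

theorem3p1 : (r s t : ℕ → Poly) →
    (∀ k → k ≥ 1 → NonNegCoeffs (r k)) →
    (∀ k → NonNegCoeffs (s k)) →
    (∀ k → k ≥ 1 → NonNegCoeffs (t k)) →
    ((s 0 ≥q r 1) × (∀ k → k ≥ 1 → s k ≥q (r (suc k) +ᴾ t k)))
    ⊎ ((s 0 ≥q t 1) × (∀ k → k ≥ 1 → s k ≥q (r k +ᴾ t (suc k))))
    ⊎ ((s 0 ≥q 1ᴾ) × (∀ k → k ≥ 1 → s k ≥q ((r k *ᴾ t k) +ᴾ 1ᴾ))) →
    q-TP (recMatrix r s t)
theorem3p1 r s t r≥0 s≥0 t≥0 =
  recMatrix-totallyPositive r s t (λ k → r≥0 (suc k) z<s) (λ k → t≥0 (suc k) z<s)
  where open TotalPositivity ℝ[q] NonNegCoeffs ℝ[q]-nonNeg
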